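{- For any positive integer $n$, there exists an $n$-bit adder tile assembly computer that has worst-case run time $O(n)$ and average-case run time $O(\log n)$.
   Context: Abstract tile assembly model (aTAM): tiles are unit squares with a glue type (with nonnegative integer strength) on each side and a label; assemblies are finite sets of translated tiles at distinct integer points; an assembly is $\tau$-stable if the min-cut of its bond graph (adjacent tiles joined with weight equal to the strength of a matching glue, $0$ if glues differ) is at least $\tau$; a tile attaches if the result stays $\tau$-stable. A tile system $(T,S,\tau)$ is deterministic (uniquely assembles $A$) if $A$ is its only terminal producible assembly. Parallel run time: with $\mathrm{PARALLEL}(A)$ the union of all assemblies obtained from $A$ by one attachment and $A\rightrightarrows A'$ meaning $A'=\mathrm{PARALLEL}(A)$, the run time is the $k$ with $S=A_1\rightrightarrows\cdots\rightrightarrows A_k$ terminal. Tile assembly computer (TAC) $(T,U,V,\tau)$: $T$ has exactly one tile $t_0$ labeled "0" and one $t_1$ labeled "1"; input template $U=(R,B)$ with $R$ an assembly over $T\setminus\{t_0,t_1\}$ and $B$ a sequence of unoccupied positions; $U_b$ places $t_{b_i}$ at $B(i)$; output template $V$ is a sequence of positions $C(i)$, and an assembly represents $c$ if the tile at $C(i)$ has label $c_i$. The TAC computes $f$ if for every input $b$, $(T,U_b,\tau)$ uniquely assembles an assembly representing $f(b)$. An $n$-bit adder TAC computes the $(n+1)$-bit binary sum of two $n$-bit numbers given as its $2n$ input bits. Run time on input $b$ is the parallel run time of $(T,U_b,\tau)$; worst case is the maximum over inputs, average case is the expectation over a uniformly random input in $\{0,1\}^{2n}$. -}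

module Defs where

open import Data.Nat using (ℕ; zero; suc; _+_; _*_; _^_; _≤_; _<_; _≡ᵇ_)
open import Data.Integer as ℤ using (ℤ)
open import Data.Bool using (Bool; true; false; if_then_else_; _∧_)
open import Data.Maybe using (Maybe; just; nothing)
open import Data.Product using (Σ; _×_; _,_; proj₁; proj₂; ∃-syntax)
open import Data.Product.Properties using (≡-dec)
open import Data.Sum using (_⊎_)
open import Data.Empty using (⊥)
open import Data.List as List using (List; []; _∷_; _++_; map)
open import Data.Nat.ListAction using (sum)
open import Data.List.Membership.Propositional using (_∈_)
open import Data.List.Relation.Unary.Any using (Any)
open import Data.List.Relation.Unary.All using (All)
open import Data.List.Relation.Unary.Unique.Propositional using (Unique)
open import Data.Vec as Vec using (Vec; lookup; take; drop; toList; zipWith)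
open import Data.Fin using (Fin)
open import Relation.Nullary using (¬_; does)
open import Relation.Binary.PropositionalEquality using (_≡_; _≢_)
open import Relation.Binary.Definitions using (DecidableEquality)

record Glue : Set where
  constructor glue
  field
    gtype    : ℕ
    strength : ℕ
open Glue public

-- A tile type: glues on the four sides and a label.
-- Labels are natural numbers; label 0 stands for "0", label 1 for "1".
record Tile : Set where
  constructor tile
  field
    north east south west : Glue
    label : ℕ
open Tile public

Pos : Set
Pos = ℤ × ℤ

_≟P_ : DecidableEquality Pos
_≟P_ = ≡-dec ℤ._≟_ ℤ._≟_

Assembly : Set
Assembly = List (Pos × Tile)

WF : Assembly → Set
WF A = Unique (map proj₁ A)

at : Assembly → Pos → Maybe Tile
at [] p = nothing
at ((q , t) ∷ A) p = if does (q ≟P p) then just t else at A p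

_≈A_ : Assembly → Assembly → Set
A ≈A B = ∀ p → at A p ≡ at B p

data Dir : Set where
  N E S W : Dir

neighbour : Dir → Pos → Pos
neighbour N (x , y) = (x , y ℤ.+ ℤ.+ 1)
neighbour E (x , y) = (x ℤ.+ ℤ.+ 1 , y)
neighbour S (x , y) = (x , y ℤ.- ℤ.+ 1)
neighbour W (x , y) = (x ℤ.- ℤ.+ 1 , y)

glueStr : Glue → Glue → ℕ
glueStr g h =
  if (gtype g ≡ᵇ gtype h) ∧ (strength g ≡ᵇ strength h) then strength g else 0

bond : Dir → Tile → Tile → ℕ
bond N t t' = glueStr (north t) (south t')
bond E t t' = glueStr (east t) (west t')
bond S t t' = glueStr (south t) (north t')
bond W t t' = glueStr (west t) (east t')

dirs : List Dir
dirs = N ∷ E ∷ S ∷ W ∷ []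

-- weight of the edges from the tile t at p (on side true of the cut X)
-- to neighbours on side false of the cut
edgesOut : Assembly → (Pos → Bool) → Pos → Tile → Dir → ℕ
edgesOut A X p t d with at A (neighbour d p)
... | nothing = 0
... | just t' = if X (neighbour d p) then 0 else bond d t t'

cutWeight : Assembly → (Pos → Bool) → ℕ
cutWeight A X =
  sum (map (λ e → if X (proj₁ e)
                    then sum (map (edgesOut A X (proj₁ e) (proj₂ e)) dirs)
                    else 0) A)

Stable : ℕ → Assembly → Set
Stable τ A = (X : Pos → Bool) →
  Any (λ e → X (proj₁ e) ≡ true) A →
  Any (λ e → X (proj₁ e) ≡ false) A →
  τ ≤ cutWeight A X

TileSet : Set
TileSet = List Tile

CanAttach : TileSet → ℕ → Assembly → Pos → Tile → Set
CanAttach T τ A p t = t ∈ T × at A p ≡ nothing × Stable τ ((p , t) ∷ A)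

Terminal : TileSet → ℕ → Assembly → Set
Terminal T τ A = ∀ p t → ¬ CanAttach T τ A p t

data Producible (T : TileSet) (τ : ℕ) (Sd : Assembly) : Assembly → Set where
  seed : ∀ {A} → WF A → A ≈A Sd → Producible T τ Sd A
  step : ∀ {A B p t} → Producible T τ Sd A → CanAttach T τ A p t →
         WF B → B ≈A ((p , t) ∷ A) → Producible T τ Sd B

UniquelyAssembles : TileSet → ℕ → Assembly → Assembly → Set
UniquelyAssembles T τ Sd A =
  Producible T τ Sd A × Terminal T τ A ×
  (∀ B → Producible T τ Sd B → Terminal T τ B → B ≈A A)

-- A ⇉ B : B = PARALLEL(A), the union of all assemblies obtained from A
-- by one attachment
ParStep : TileSet → ℕ → Assembly → Assembly → Set
ParStep T τ A B =
  (∀ p t → at A p ≡ just t → at B p ≡ just t) ×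
  (∀ p t → CanAttach T τ A p t → at B p ≡ just t) ×
  (∀ p t → at B p ≡ just t → (at A p ≡ just t) ⊎ CanAttach T τ A p t)

-- RunTime T τ Sd k : the parallel run time of (T, Sd, τ) is k, i.e.
-- Sd = A₁ ⇉ A₂ ⇉ ⋯ ⇉ A_k with A_k terminal (and no earlier Aᵢ terminal).
-- Here Aᵢ is written A (i - 1).
RunTime : TileSet → ℕ → Assembly → ℕ → Set
RunTime T τ Sd zero = ⊥
RunTime T τ Sd (suc m) = Σ (ℕ → Assembly) λ A →
  (∀ i → i ≤ m → WF (A i)) ×
  A 0 ≈A Sd ×
  (∀ i → i < m → ParStep T τ (A i) (A (suc i))) ×
  Terminal T τ (A m) ×
  (∀ i → i < m → ¬ Terminal T τ (A i))

bitTile : Tile → Tile → Bool → Tile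
bitTile t0 t1 true  = t1
bitTile t0 t1 false = t0

bitLabel : Bool → ℕ
bitLabel true  = 1
bitLabel false = 0

-- A TAC (T, U, V, τ) with m input bits and k output bits,
-- U = (R, B) input template, V = C output template.
record TAC (m k : ℕ) : Set where
  field
    tiles : TileSet
    t0 t1 : Tile
    t0∈ : t0 ∈ tiles
    t1∈ : t1 ∈ tiles
    t0-label : label t0 ≡ 0
    t1-label : label t1 ≡ 1
    t0-unique : ∀ t → t ∈ tiles → label t ≡ 0 → t ≡ t0
    t1-unique : ∀ t → t ∈ tiles → label t ≡ 1 → t ≡ t1
    R : Assembly
    R-wf : WF R
    R-over : All (λ e → proj₂ e ∈ tiles × proj₂ e ≢ t0 × proj₂ e ≢ t1) R
    B : Vec Pos m
    B-distinct : Unique (toList B)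
    B-free : ∀ i → at R (lookup B i) ≡ nothing
    C : Vec Pos k
    τ : ℕ
open TAC public

inputAsm : ∀ {m k} → TAC m k → Vec Bool m → Assembly
inputAsm M b =
  R M ++ toList (zipWith (λ p x → (p , bitTile (t0 M) (t1 M) x)) (B M) b)

Represents : ∀ {k} → Vec Pos k → Assembly → Vec Bool k → Set
Represents C A c = ∀ i → ∃[ t ] (at A (lookup C i) ≡ just t × label t ≡ bitLabel (lookup c i))

Computes : ∀ {m k} → TAC m k → (Vec Bool m → Vec Bool k) → Set
Computes M f = ∀ b → ∃[ A ] (UniquelyAssembles (tiles M) (τ M) (inputAsm M b) A
                             × Represents (C M) A (f b))

val : ∀ {m} → Vec Bool m → ℕ
val Vec.[] = 0
val (x Vec.∷ xs) = (if x then 1 else 0) + 2 * val xs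

IsAdder : ∀ n → TAC (n + n) (suc n) → Set
IsAdder n M = Σ (Vec Bool (n + n) → Vec Bool (suc n)) λ f →
  Computes M f × (∀ b → val (f b) ≡ val (take n b) + val (drop n b))

allVecs : ∀ m → List (Vec Bool m)
allVecs zero = Vec.[] ∷ []
allVecs (suc m) = map (true Vec.∷_) (allVecs m) ++ map (false Vec.∷_) (allVecs m)

{-# OPTIONS --safe #-}

-- Each bit occupies three columns, and the carry runs east through one row at temperature 2.  A bit
-- with a = b sends its carry on as soon as a and b have been combined; a bit with a ≠ b waits for
-- the incoming carry.  Hence every tile is attached by time 7 + 3 d, where d is the length of the
-- run of waiting bits before it.  The longest run is at most n, and since the expectation of
-- 2 ^ longest is O(n²), its mean is O(log n).
--
-- The glues are redundant: wherever the seed is absent, no tile other than the intended one is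
-- attracted with strength 2, even by the complete final assembly.  So every producible assembly is
-- part of the final one, whatever the order of attachment.  This local condition involves three
-- consecutive columns only, and there are finitely many cases, which are decided by evaluation.

module Submission where

open import Defs
open import Algebra.Bundles using (AbelianGroup)
open import Data.Nat using (ℕ; zero; suc; _+_; _*_; _^_; _⊔_; _≤_; _<_; z≤n; s≤s; _≡ᵇ_; _≤ᵇ_; _≤?_)
open import Data.Nat.Induction using (<-rec)
open import Data.Nat.ListAction using (sum)
open import Data.Nat.ListAction.Properties using (sum-++; sum-↭)
open import Data.Nat.Logarithm using (⌊log₂_⌋; ⌊log₂⌋-mono-≤; ⌊log₂[2^n]⌋≡n)
open import Data.Nat.Properties as ℕ using (≤-refl; ≤-trans; ≤-reflexive; +-mono-≤; +-monoˡ-≤; m≤m+n; m≤n+m; +-identityʳ)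
open import Data.Nat.Solver using (module +-*-Solver)
open +-*-Solver using (solve; con; _:+_; _:*_; _:=_)
open import Data.Integer as ℤ using (ℤ; -[1+_])
import Data.Integer.Properties as ℤ
open import Algebra.Properties.Group (AbelianGroup.group ℤ.+-0-abelianGroup) using (identityʳ-unique)
open import Data.Bool using (Bool; true; false; if_then_else_; _∧_; _∨_; _xor_; not; T)
open import Data.Bool.ListAction using (all; any)
open import Data.Bool.Properties using (_≟_)
open import Data.Maybe as Maybe using (Maybe; just; nothing; _<∣>_; is-just)
open import Data.Product using (Σ; _×_; _,_; proj₁; proj₂; ∃-syntax)
open import Data.Sum using (_⊎_; inj₁; inj₂)
open import Data.Fin using (Fin; zero; suc; toℕ; _↑ˡ_; _↑ʳ_; splitAt)
open import Data.Fin.Properties using (toℕ-injective)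
open import Data.Vec as Vec using (Vec; []; _∷_; lookup; toList; zipWith; replicate; take; drop)
open import Data.Vec.Properties
  using (lookup∘tabulate; lookup-++ˡ; lookup-++ʳ; lookup-splitAt; lookup-zipWith; toList-++; take++drop≡id)
import Data.Vec.Membership.Propositional.Properties as Vec∈
open import Data.List as List using (List; []; _∷_; _++_; map; filter; upTo; cartesianProductWith)
open import Data.List.Properties using (map-++; map-∘)
open import Data.List.Membership.Propositional using (_∈_; find; lose)
open import Data.List.Membership.Propositional.Properties
  using (∈-map⁺; ∈-map⁻; ∈-filter⁺; ∈-filter⁻; ∈-++⁺ˡ; ∈-++⁺ʳ; ∈-++⁻; ∈-upTo⁺; ∈-cartesianProductWith⁺; ∈-tabulate⁻)
open import Data.List.Membership.Propositional.Properties.WithK using (unique∧set⇒bag)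
open import Data.List.Relation.Binary.BagAndSetEquality using (∼bag⇒↭)
open import Data.List.Relation.Binary.Permutation.Propositional using (_↭_)
open import Data.List.Relation.Binary.Permutation.Propositional.Properties using (map⁺)
open import Data.List.Relation.Unary.Any as Any using (Any; here; there; any?)
open import Data.List.Relation.Unary.All as All using (All; []; _∷_; all?)
open import Data.List.Relation.Unary.AllPairs using ([]; _∷_)
open import Data.List.Relation.Unary.Unique.Propositional using (Unique)
open import Data.List.Relation.Unary.Unique.Propositional.Properties
  using (map⁻; upTo⁺; cartesianProductWith⁺; tabulate⁺; ++⁺)
open import Function using (_∘_; mk⇔)
open import Relation.Nullary using (¬_; Dec; yes; no; does; contradiction)
open import Relation.Nullary.Decidable using (dec-true; dec-false; _×-dec_; ¬?)
open import Relation.Unary using (Decidable)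
open import Relation.Binary.PropositionalEquality

-- Assemblies, attraction and stability

-- Only one tile is labelled 0 and one labelled 1, so an output bit is the very tile that also
-- serves as an input bit and offers its value to the logic. The frame has to keep it away from
-- every cell but its own. An output is therefore held by two glues of strength 1, one of which is
-- its value.
--
-- Stability quantifies over all cuts of a growing assembly. A tile added to a nonempty stable
-- assembly keeps it stable exactly when the tile itself is bound with strength at least τ. So, once
-- the seed is known to be stable, only sums of four bonds matter: from above against the final
-- assembly (`sound`), from below against neighbours of smaller `time` (`progress`).
--
-- For the average, `2 ^ longest` is at most the sum of `2 ^ d` over all positions. One more bit
-- doubles `2 ^ d` for half of the pairs (a, b) and resets it to 1 for the other half, so its mean
-- grows by 1/2 per bit and the sum is quadratic. A cut-off at L, about 2 log₂ n, takes the place of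
-- the concavity of the logarithm and keeps the argument within the natural numbers.

at-here : ∀ p {t} A → at ((p , t) ∷ A) p ≡ just t
at-here p A rewrite dec-true (p ≟P p) refl = refl

at-there : ∀ {p q t} A → q ≢ p → at ((q , t) ∷ A) p ≡ at A p
at-there {p} {q} A q≢p rewrite dec-false (q ≟P p) q≢p = refl

at⇒∈ : ∀ A {p t} → at A p ≡ just t → (p , t) ∈ A
at⇒∈ ((q , s) ∷ A) {p} eq with q ≟P p
at⇒∈ ((q , s) ∷ A) {p} refl | yes refl = here refl
... | no _ = there (at⇒∈ A eq)

∈⇒at : ∀ {A p t} → WF A → (p , t) ∈ A → at A p ≡ just t
∈⇒at {A = _ ∷ A} _ (here refl) = at-here _ A
∈⇒at {A = (q , s) ∷ A} (q∉A ∷ wf) (there p∈A) =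
  trans (at-there A (All.lookup q∉A (∈-map⁺ proj₁ p∈A))) (∈⇒at wf p∈A)

at≡nothing⇒≢ : ∀ {A p q t} → at A p ≡ nothing → (q , t) ∈ A → p ≢ q
at≡nothing⇒≢ {A = (r , s) ∷ A} {p} eq q∈ p≡q with r ≟P p
at≡nothing⇒≢ {A = (r , s) ∷ A} {p} () q∈ p≡q | yes _
at≡nothing⇒≢ {A = (r , s) ∷ A} {p} eq (here refl) p≡q | no r≢p = r≢p (sym p≡q)
at≡nothing⇒≢ {A = (r , s) ∷ A} {p} eq (there q∈) p≡q | no _ = at≡nothing⇒≢ eq q∈ p≡q

WF-∷ : ∀ {A p t} → at A p ≡ nothing → WF A → WF ((p , t) ∷ A)
WF-∷ {A} {p} eq wf = All.tabulate fresh ∷ wf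
  where
  fresh : ∀ {q} → q ∈ map proj₁ A → p ≢ q
  fresh q∈ with (q , t) , q∈A , refl ← ∈-map⁻ proj₁ q∈ = at≡nothing⇒≢ eq q∈A

-- Membership is easy to prove for concatenations and tabulations, lookup is not. Without repeated
-- positions the two agree, so two inclusions of graphs suffice.
at≡graph : ∀ {A} {h : Pos → Maybe Tile} → WF A →
  (∀ {p t} → (p , t) ∈ A → h p ≡ just t) →
  (∀ {p t} → h p ≡ just t → (p , t) ∈ A) → ∀ p → at A p ≡ h p
at≡graph {A} {h} wf ⊆h h⊆ p with at A p in eqA | h p in eqh
... | just t | y = trans (sym (⊆h (at⇒∈ A eqA))) eqh
... | nothing | nothing = refl
... | nothing | just t = trans (sym eqA) (∈⇒at wf (h⊆ eqh))

-- `cutWeight` sums over the list, so its invariance under `≈A` goes through a permutation.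
≈A⇒↭ : ∀ {A B} → WF A → WF B → A ≈A B → A ↭ B
≈A⇒↭ {A} {B} wfA wfB A≈B = ∼bag⇒↭ (unique∧set⇒bag (map⁻ wfA) (map⁻ wfB)
  (mk⇔ (λ e∈A → at⇒∈ B (trans (sym (A≈B _)) (∈⇒at wfA e∈A)))
       (λ e∈B → at⇒∈ A (trans (A≈B _) (∈⇒at wfB e∈B)))))

opp : Dir → Dir
opp N = S
opp E = W
opp S = N
opp W = E

+1-1 : ∀ i → (i ℤ.+ ℤ.+ 1) ℤ.- ℤ.+ 1 ≡ i
+1-1 i = trans (ℤ.+-assoc i (ℤ.+ 1) (ℤ.- ℤ.+ 1)) (ℤ.+-identityʳ i)

-1+1 : ∀ i → (i ℤ.- ℤ.+ 1) ℤ.+ ℤ.+ 1 ≡ i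
-1+1 i = trans (ℤ.+-assoc i (ℤ.- ℤ.+ 1) (ℤ.+ 1)) (ℤ.+-identityʳ i)

i+1≢i : ∀ i → i ℤ.+ ℤ.+ 1 ≢ i
i+1≢i i eq with () ← identityʳ-unique i (ℤ.+ 1) eq

i-1≢i : ∀ i → i ℤ.- ℤ.+ 1 ≢ i
i-1≢i i eq with () ← identityʳ-unique i (ℤ.- ℤ.+ 1) eq

neighbour-opp : ∀ d p → neighbour d (neighbour (opp d) p) ≡ p
neighbour-opp N (x , y) = cong (x ,_) (-1+1 y)
neighbour-opp E (x , y) = cong (_, y) (-1+1 x)
neighbour-opp S (x , y) = cong (x ,_) (+1-1 y)
neighbour-opp W (x , y) = cong (_, y) (+1-1 x)

neighbour≢ : ∀ d p → neighbour d p ≢ p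
neighbour≢ N (x , y) eq = i+1≢i y (cong proj₂ eq)
neighbour≢ E (x , y) eq = i+1≢i x (cong proj₁ eq)
neighbour≢ S (x , y) eq = i-1≢i y (cong proj₂ eq)
neighbour≢ W (x , y) eq = i-1≢i x (cong proj₁ eq)

≡ᵇ-sym : ∀ m n → (m ≡ᵇ n) ≡ (n ≡ᵇ m)
≡ᵇ-sym zero zero = refl
≡ᵇ-sym zero (suc n) = refl
≡ᵇ-sym (suc m) zero = refl
≡ᵇ-sym (suc m) (suc n) = ≡ᵇ-sym m n

≡ᵇ-cases : ∀ (c : Bool) m n → (if c ∧ (m ≡ᵇ n) then m else 0) ≡ (if c ∧ (m ≡ᵇ n) then n else 0)
≡ᵇ-cases false m n = refl
≡ᵇ-cases true m n with m ≡ᵇ n in eq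
... | true = ℕ.≡ᵇ⇒≡ m n (subst (λ b → T b) (sym eq) _)
... | false = refl

-- `glueStr` returns the strength of its first argument, but a nonzero result presupposes that both
-- strengths are equal.
glueStr-sym : ∀ g h → glueStr g h ≡ glueStr h g
glueStr-sym g h
  rewrite ≡ᵇ-sym (gtype h) (gtype g) | ≡ᵇ-sym (strength h) (strength g)
  = ≡ᵇ-cases (gtype g ≡ᵇ gtype h) (strength g) (strength h)

bond-opp : ∀ d s t → bond d s t ≡ bond (opp d) t s
bond-opp N s t = glueStr-sym (north s) (south t)
bond-opp E s t = glueStr-sym (east s) (west t)
bond-opp S s t = glueStr-sym (south s) (north t)
bond-opp W s t = glueStr-sym (west s) (east t)

bond? : Dir → Tile → Maybe Tile → ℕ
bond? d t nothing   = 0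
bond? d t (just t′) = bond d t t′

-- Defined on partial maps, since it is applied not only to assemblies but also to the column
-- description of the final assembly and to maps known only at earlier positions.
attraction : (Pos → Maybe Tile) → Pos → Tile → ℕ
attraction f p t = sum (map (λ d → bond? d t (f (neighbour d p))) dirs)

sum-map-mono : ∀ {ℓ} {A : Set ℓ} {f g : A → ℕ} xs → (∀ {x} → x ∈ xs → f x ≤ g x) →
  sum (map f xs) ≤ sum (map g xs)
sum-map-mono [] le = z≤n
sum-map-mono (x ∷ xs) le = +-mono-≤ (le (here refl)) (sum-map-mono xs (le ∘ there))

sum-map-cong : ∀ {ℓ} {A : Set ℓ} {f g : A → ℕ} xs → (∀ {x} → x ∈ xs → f x ≡ g x) →
  sum (map f xs) ≡ sum (map g xs)
sum-map-cong [] eq = refl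
sum-map-cong (x ∷ xs) eq = cong₂ _+_ (eq (here refl)) (sum-map-cong xs (eq ∘ there))

≤sum-map : ∀ {ℓ} {A : Set ℓ} (f : A → ℕ) {x xs} → x ∈ xs → f x ≤ sum (map f xs)
≤sum-map f (here refl) = m≤m+n _ _
≤sum-map f (there x∈) = ≤-trans (≤sum-map f x∈) (m≤n+m _ _)

attraction-mono : ∀ f g → (∀ {p t} → f p ≡ just t → g p ≡ just t) →
  ∀ p t → attraction f p t ≤ attraction g p t
attraction-mono f g f⊆g p t = sum-map-mono dirs λ {d} _ → le d
  where
  le : ∀ d → bond? d t (f (neighbour d p)) ≤ bond? d t (g (neighbour d p))
  le d with f (neighbour d p) in eq
  ... | nothing = z≤n
  ... | just t′ rewrite f⊆g eq = ≤-refl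

attraction-cong : ∀ {f g} → (∀ p → f p ≡ g p) → ∀ p t → attraction f p t ≡ attraction g p t
attraction-cong eq p t = sum-map-cong dirs λ {d} _ → cong (bond? d t) (eq (neighbour d p))

edgesOut-cong : ∀ {A B} → A ≈A B → ∀ X p t d → edgesOut A X p t d ≡ edgesOut B X p t d
edgesOut-cong {A} {B} A≈B X p t d rewrite A≈B (neighbour d p) = refl

edgesOut-crossing : ∀ A X p t d → (∀ {t′} → at A (neighbour d p) ≡ just t′ → X (neighbour d p) ≡ false) →
  edgesOut A X p t d ≡ bond? d t (at A (neighbour d p))
edgesOut-crossing A X p t d out with at A (neighbour d p)
... | nothing = refl
... | just t′ rewrite out refl = refl

edgesOut-∷ : ∀ {A q s} → at A q ≡ nothing → ∀ X p t d →
  edgesOut A X p t d ≤ edgesOut ((q , s) ∷ A) X p t d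
edgesOut-∷ {A} {q} free X p t d with q ≟P neighbour d p
... | yes refl rewrite free = z≤n
... | no  _ = ≤-refl

cutTerm : Assembly → (Pos → Bool) → Pos × Tile → ℕ
cutTerm A X e = if X (proj₁ e) then sum (map (edgesOut A X (proj₁ e) (proj₂ e)) dirs) else 0

cutTerm-∷ : ∀ {A q s} → at A q ≡ nothing → ∀ X e → cutTerm A X e ≤ cutTerm ((q , s) ∷ A) X e
cutTerm-∷ {A} {q} {s} free X e with X (proj₁ e)
... | true = sum-map-mono dirs λ {d} _ → edgesOut-∷ {A} {q} {s} free X (proj₁ e) (proj₂ e) d
... | false = z≤n

Stable-resp-≈A : ∀ {τ A B} → WF A → WF B → A ≈A B → Stable τ A → Stable τ B
Stable-resp-≈A {τ} {A} {B} wfA wfB A≈B st X onTrue onFalse =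
  subst (τ ≤_) cut≡ (st X (transfer onTrue) (transfer onFalse))
  where
  A↭B = ≈A⇒↭ wfA wfB A≈B
  transfer : ∀ {b} → Any (λ e → X (proj₁ e) ≡ b) B → Any (λ e → X (proj₁ e) ≡ b) A
  transfer x with e , e∈ , Xe ← find x =
    lose (at⇒∈ A (trans (A≈B _) (∈⇒at wfB e∈))) Xe
  term≡ : ∀ e → cutTerm A X e ≡ cutTerm B X e
  term≡ e = cong (λ n → if X (proj₁ e) then n else 0)
    (sum-map-cong dirs λ {d} _ → edgesOut-cong {A} {B} A≈B X (proj₁ e) (proj₂ e) d)
  cut≡ : cutWeight A X ≡ cutWeight B X
  cut≡ = trans (sum-↭ (map⁺ (cutTerm A X) A↭B)) (sum-map-cong B λ {e} _ → term≡ e)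

-- For a new tile on the false side of a cut: its bonds are charged to its neighbours and have to be
-- regrouped by direction.
sum-dirs-swap : ∀ {ℓ} {A : Set ℓ} (G : A → Dir → ℕ) xs →
  sum (map (λ e → sum (map (G e) dirs)) xs) ≡ sum (map (λ d → sum (map (λ e → G e d) xs)) dirs)
sum-dirs-swap G [] = refl
sum-dirs-swap G (x ∷ xs) rewrite sum-dirs-swap G xs =
  solve 8 (λ a b c d a′ b′ c′ d′ →
      (a :+ (b :+ (c :+ (d :+ con 0)))) :+ (a′ :+ (b′ :+ (c′ :+ (d′ :+ con 0)))) :=
      (a :+ a′) :+ ((b :+ b′) :+ ((c :+ c′) :+ ((d :+ d′) :+ con 0)))) refl
    (G x N) (G x E) (G x S) (G x W) _ _ _ _

-- When a cut separates p from all of A, the bonds at p are counted either at p or at its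
-- neighbours, depending on the side of the cut on which p lies.
attach-stable : ∀ {τ A p t} → at A p ≡ nothing → WF A → Stable τ A →
  τ ≤ attraction (at A) p t → Stable τ ((p , t) ∷ A)
attach-stable {τ} {A} {p} {t} free wf st τ≤ X onTrue onFalse
  with any? (λ e → X (proj₁ e) ≟ true) A | any? (λ e → X (proj₁ e) ≟ false) A
... | yes tA | yes fA = ≤-trans (st X tA fA) (≤-trans (sum-map-mono A (λ {e} _ → cutTerm-∷ {A} {p} {t} free X e)) (m≤n+m _ _))
... | no ¬tA | _ = ≤-trans τ≤ (≤-trans (≤-reflexive (sym head≡)) (m≤m+n _ _))
  where
  Xp : X p ≡ true
  Xp = Any.head ¬tA onTrue
  at≡ : ∀ d → at ((p , t) ∷ A) (neighbour d p) ≡ at A (neighbour d p)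
  at≡ d = at-there A (neighbour≢ d p ∘ sym)
  out : ∀ d {t′} → at ((p , t) ∷ A) (neighbour d p) ≡ just t′ → X (neighbour d p) ≡ false
  out d eq with X (neighbour d p) in Xq
  ... | false = refl
  ... | true = contradiction (lose (at⇒∈ A (trans (sym (at≡ d)) eq)) Xq) ¬tA
  head≡ : cutTerm ((p , t) ∷ A) X (p , t) ≡ attraction (at A) p t
  head≡ rewrite Xp = sum-map-cong dirs λ {d} _ →
    trans (edgesOut-crossing ((p , t) ∷ A) X p t d (out d)) (cong (bond? d t) (at≡ d))
... | yes _ | no ¬fA = ≤-trans τ≤ (≤-trans per-dir (≤-trans (≤-reflexive (sym rearrange)) (m≤n+m _ _)))
  where
  A′ = (p , t) ∷ A
  Xp : X p ≡ false
  Xp = Any.head ¬fA onFalse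
  Xq : ∀ {e} → e ∈ A → X (proj₁ e) ≡ true
  Xq {e} e∈ with X (proj₁ e) in eq
  ... | true = refl
  ... | false = contradiction (lose e∈ eq) ¬fA
  G : Pos × Tile → Dir → ℕ
  G e d = edgesOut A′ X (proj₁ e) (proj₂ e) d
  rearrange : sum (map (cutTerm A′ X) A) ≡ sum (map (λ d → sum (map (λ e → G e d) A)) dirs)
  rearrange = trans
    (sum-map-cong A λ {e} e∈ → cong (λ b → if b then sum (map (G e) dirs) else 0) (Xq e∈))
    (sum-dirs-swap G A)
  one : ∀ d → bond? (opp d) t (at A (neighbour (opp d) p)) ≤ sum (map (λ e → G e d) A)
  one d with at A (neighbour (opp d) p) in eq
  ... | nothing = z≤n
  ... | just t′ = ≤-trans (≤-reflexive (sym G≡)) (≤sum-map (λ e → G e d) (at⇒∈ A eq))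
    where
    G≡ : G (neighbour (opp d) p , t′) d ≡ bond (opp d) t t′
    G≡ = trans (edgesOut-crossing A′ X _ t′ d (λ _ → trans (cong X (neighbour-opp d p)) Xp))
      (trans (cong (bond? d t′) (trans (cong (at A′) (neighbour-opp d p)) (at-here p A))) (bond-opp d t′ t))
  open ℕ.≤-Reasoning
  per-dir : attraction (at A) p t ≤ sum (map (λ d → sum (map (λ e → G e d) A)) dirs)
  per-dir = begin
    attraction (at A) p t
      -- `one d` bounds the bond on side `opp d`, so the sides N, E, S, W call for S, W, N, E.
      ≤⟨ +-mono-≤ (one S) (+-mono-≤ (one W) (+-mono-≤ (one N) (+-mono-≤ (one E) ≤-refl))) ⟩
    _ ≡⟨ solve 4 (λ n e s w → s :+ (w :+ (n :+ (e :+ con 0))) := n :+ (e :+ (s :+ (w :+ con 0)))) refl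
           (sum (map (λ e → G e N) A)) (sum (map (λ e → G e E) A))
           (sum (map (λ e → G e S) A)) (sum (map (λ e → G e W) A)) ⟩
    _ ∎
  
-- The cut isolating p has weight exactly the attraction of t.
attach-needs : ∀ {τ A p t e} → at A p ≡ nothing → e ∈ A → Stable τ ((p , t) ∷ A) →
  τ ≤ attraction (at A) p t
attach-needs {τ} {A} {p} {t} {e} free e∈ st = subst (τ ≤_) cut≡ (st X
    (here (dec-true (p ≟P p) refl))
    (there (lose e∈ (X≡false e∈))))
  where
  X : Pos → Bool
  X q = does (q ≟P p)
  X≡false : ∀ {e} → e ∈ A → X (proj₁ e) ≡ false
  X≡false e∈ = dec-false (_ ≟P p) (at≡nothing⇒≢ free e∈ ∘ sym)
  head≡ : cutTerm ((p , t) ∷ A) X (p , t) ≡ attraction (at A) p t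
  head≡ rewrite dec-true (p ≟P p) refl = sum-map-cong dirs λ {d} _ →
    trans (edgesOut-crossing ((p , t) ∷ A) X p t d (λ _ → dec-false (_ ≟P p) (neighbour≢ d p)))
          (cong (bond? d t) (at-there A (neighbour≢ d p ∘ sym)))
  rest≡ : ∀ xs → (∀ {e} → e ∈ xs → X (proj₁ e) ≡ false) → sum (map (cutTerm ((p , t) ∷ A) X) xs) ≡ 0
  rest≡ [] _ = refl
  rest≡ (x ∷ xs) eq rewrite eq (here refl) = rest≡ xs (eq ∘ there)
  cut≡ : cutWeight ((p , t) ∷ A) X ≡ attraction (at A) p t
  cut≡ = trans (cong₂ _+_ head≡ (rest≡ A X≡false)) (+-identityʳ _)

-- If the bond crossed the cut, it alone would contribute τ. `cutWeight` counts an edge from its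
-- true end only, hence one case for each orientation.
strong-edge : ∀ {τ A p t t′} d X → cutWeight A X < τ → WF A → at A p ≡ just t → at A (neighbour d p) ≡ just t′ →
  τ ≤ bond d t t′ → X p ≡ X (neighbour d p)
strong-edge {τ} {A} {p} {t} {t′} d X small wf atp atq strong with X p in Xp | X (neighbour d p) in Xq
... | true  | true  = refl
... | false | false = refl
... | true  | false = contradiction (≤-trans strong (≤-trans term≥ (≤sum-map (cutTerm A X) (at⇒∈ A atp)))) (ℕ.<⇒≱ small)
  where
  d∈ : ∀ d → d ∈ dirs
  d∈ N = here refl
  d∈ E = there (here refl)
  d∈ S = there (there (here refl))
  d∈ W = there (there (there (here refl)))
  edge≡ : edgesOut A X p t d ≡ bond d t t′
  edge≡ rewrite atq | Xq = refl
  term≥ : bond d t t′ ≤ cutTerm A X (p , t)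
  term≥ rewrite Xp = ≤-trans (≤-reflexive (sym edge≡)) (≤sum-map (edgesOut A X p t) (d∈ d))
... | false | true  = contradiction (≤-trans strong (≤-trans term≥ (≤sum-map (cutTerm A X) (at⇒∈ A atq)))) (ℕ.<⇒≱ small)
  where
  q = neighbour d p
  d∈ : ∀ d → opp d ∈ dirs
  d∈ S = here refl
  d∈ W = there (here refl)
  d∈ N = there (there (here refl))
  d∈ E = there (there (there (here refl)))
  opp-opp : ∀ d → opp (opp d) ≡ d
  opp-opp N = refl
  opp-opp E = refl
  opp-opp S = refl
  opp-opp W = refl
  back : neighbour (opp d) q ≡ p
  back = subst (λ d′ → neighbour (opp d) (neighbour d′ p) ≡ p) (opp-opp d) (neighbour-opp (opp d) p)
  edge≡ : edgesOut A X q t′ (opp d) ≡ bond (opp d) t′ t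
  edge≡ = trans (edgesOut-crossing A X q t′ (opp d) (λ _ → trans (cong X back) Xp))
    (cong (bond? (opp d) t′) (trans (cong (at A) back) atp))
  term≥ : bond d t t′ ≤ cutTerm A X (q , t′)
  term≥ rewrite Xq = ≤-trans (≤-reflexive (trans (bond-opp d t t′) (sym edge≡))) (≤sum-map (edgesOut A X q t′) (d∈ d))

-- Contrapositive form of stability: a cut lighter than τ cannot separate anything. Together with
-- `strong-edge` it reduces stability to connectedness by bonds of strength τ.
connected⇒Stable : ∀ {τ A} → (∀ X → cutWeight A X < τ → ∃[ v ] (∀ {p t} → at A p ≡ just t → X p ≡ v)) →
  WF A → Stable τ A
connected⇒Stable {τ} {A} conn wf X onTrue onFalse with τ ≤? cutWeight A X
... | yes le = le
... | no ¬le with v , const ← conn X (ℕ.≰⇒> ¬le)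
             with (_ , _) , e∈ , Xe ← find onTrue
             with (_ , _) , e′∈ , Xe′ ← find onFalse
  = contradiction (trans (sym (trans (const (∈⇒at wf e∈)) (sym (const (∈⇒at wf e′∈))))) Xe) (λ eq → false≢true (trans (sym Xe′) eq))
  where
  false≢true : false ≢ true
  false≢true ()

-- Growth towards a target assembly

≈A-sym : ∀ {A B} → A ≈A B → B ≈A A
≈A-sym eq p = sym (eq p)

≈A-trans : ∀ {A B C} → A ≈A B → B ≈A C → A ≈A C
≈A-trans eq eq′ p = trans (eq p) (eq′ p)

Producible-WF : ∀ {T τ Sd A} → Producible T τ Sd A → WF A
Producible-WF (seed wf _) = wf
Producible-WF (step _ _ wf _) = wf

WF-filter : ∀ {P : Pos × Tile → Set} (P? : Decidable P) {A} → WF A → WF (filter P? A)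
WF-filter P? {[]} [] = []
WF-filter P? {e ∷ A} (e∉A ∷ wf) with does (P? e)
... | false = WF-filter P? wf
... | true = All.tabulate (λ q∈ → All.lookup e∉A (incl q∈)) ∷ WF-filter P? wf
  where
  incl : ∀ {q} → q ∈ map proj₁ (filter P? A) → q ∈ map proj₁ A
  incl q∈ with e′ , e′∈ , refl ← ∈-map⁻ proj₁ q∈ = ∈-map⁺ proj₁ (proj₁ (∈-filter⁻ P? e′∈))

nothing? : (m : Maybe Tile) → Dec (m ≡ nothing)
nothing? nothing = yes refl
nothing? (just _) = no λ ()

least : ∀ {P : ℕ → Set} → Decidable P → ∀ D → P D → ∃[ m ] m ≤ D × P m × (∀ i → i < m → ¬ P i)
least {P} P? D PD with P? 0
... | yes P0 = 0 , z≤n , P0 , λ _ ()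
least {P} P? zero PD | no ¬P0 = contradiction PD ¬P0
least {P} P? (suc D) PD | no ¬P0 with m , m≤D , Pm , min ← least (P? ∘ suc) D PD
  = suc m , s≤s m≤D , Pm , λ { zero _ → ¬P0 ; (suc i) (s≤s i<m) → min i i<m }

-- sound refers to all neighbours in F, including those that attach after p, so that no invariant on
-- the order of attachment is needed.
record IsTarget (T : TileSet) (τ : ℕ) (Sd F : Assembly) (isSeed : Pos → Bool) (time : Pos → ℕ) (D : ℕ) : Set where
  field
    F-wf      : WF F
    Sd-wf     : WF Sd
    Sd-stable : Stable τ Sd
    Sd-nonempty : ∃[ e ] e ∈ Sd
    Sd-at     : ∀ p → at Sd p ≡ (if isSeed p then at F p else nothing)
    seed⇒F    : ∀ {p} → isSeed p ≡ true → ∃[ t ] at F p ≡ just t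
    sound     : ∀ {p t} → t ∈ T → isSeed p ≡ false → τ ≤ attraction (at F) p t → at F p ≡ just t
    F-tiles   : ∀ {p t} → at F p ≡ just t → isSeed p ≡ false → t ∈ T
    progress  : ∀ {p t} → at F p ≡ just t → isSeed p ≡ false → ∀ g →
                (∀ q → isSeed q ≡ true ⊎ time q < time p → g q ≡ at F q) → τ ≤ attraction g p t
    time≤D    : ∀ {p t} → at F p ≡ just t → isSeed p ≡ false → time p ≤ D

module Growth {T τ Sd F isSeed time D} (target : IsTarget T τ Sd F isSeed time D) where
  open IsTarget target

  -- The invariant of producible assemblies. `stable` makes attachment a matter of attraction alone,
  -- `⊆F` makes `sound` applicable, and `seed⊆` provides the static neighbours that `progress`
  -- relies on.
  record Partial (A : Assembly) : Set where
    field
      wf     : WF A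
      stable : Stable τ A
      ⊆F     : ∀ {p t} → at A p ≡ just t → at F p ≡ just t
      seed⊆  : ∀ {p} → isSeed p ≡ true → at A p ≡ at F p
  open Partial

  free⇒nonseed : ∀ {A p t} → Partial A → at A p ≡ nothing → at F p ≡ just t → isSeed p ≡ false
  free⇒nonseed {p = p} PA free Fp with isSeed p in eq
  ... | false = refl
  ... | true with () ← trans (sym free) (trans (seed⊆ PA eq) Fp)

  -- The cut that isolates a new tile in `attach-needs` requires a tile on its other side.
  occupied : ∀ {A} → Partial A → ∃[ e ] e ∈ A
  occupied {A} PA with (p , t) , e∈ ← Sd-nonempty
                  with isSeed p in eq | Sd-at p | ∈⇒at Sd-wf e∈
  ... | true | Sd≡ | Sdp = (p , t) , at⇒∈ A (trans (seed⊆ PA eq) (trans (sym Sd≡) Sdp))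
  ... | false | Sd≡ | Sdp with () ← trans (sym Sdp) Sd≡

  partial-≈ : ∀ {A B} → WF B → B ≈A A → Partial A → Partial B
  partial-≈ {A} {B} wfB B≈A PA = record
    { wf = wfB
    ; stable = Stable-resp-≈A (wf PA) wfB (≈A-sym {B} {A} B≈A) (stable PA)
    ; ⊆F = λ {p} eq → ⊆F PA (trans (sym (B≈A p)) eq)
    ; seed⊆ = λ {p} s → trans (B≈A p) (seed⊆ PA s)
    }

  partial-seed : Partial Sd
  partial-seed = record
    { wf = Sd-wf
    ; stable = Sd-stable
    ; ⊆F = incl
    ; seed⊆ = λ {p} s → trans (Sd-at p) (cong (λ b → if b then at F p else nothing) s)
    }
    where
    incl : ∀ {p t} → at Sd p ≡ just t → at F p ≡ just t
    incl {p} eq with isSeed p | Sd-at p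
    ... | true  | Sd≡ = trans (sym Sd≡) eq
    ... | false | Sd≡ with () ← trans (sym eq) Sd≡

  -- The bonds to A are among the bonds to `F`, so whatever A attracts with strength τ is attracted
  -- by `F` as well, and `sound` identifies it.
  attach⇒F : ∀ {A p t} → Partial A → CanAttach T τ A p t → at F p ≡ just t
  attach⇒F {A} {p} {t} PA (t∈T , free , st) with isSeed p in eq
  ... | false = sound t∈T eq (≤-trans (attach-needs {A = A} free (proj₂ (occupied PA)) st) (attraction-mono (at A) (at F) (⊆F PA) p t))
  ... | true with _ , Fp ← seed⇒F eq with () ← trans (sym free) (trans (seed⊆ PA eq) Fp)

  attach : ∀ {A p t} → Partial A → at A p ≡ nothing → at F p ≡ just t →
    τ ≤ attraction (at A) p t → CanAttach T τ A p t
  attach {A} PA free Fp τ≤ =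
    F-tiles Fp (free⇒nonseed PA free Fp) , free , attach-stable {A = A} free (wf PA) (stable PA) τ≤

  partial-∷ : ∀ {A p t} → Partial A → CanAttach T τ A p t → Partial ((p , t) ∷ A)
  partial-∷ {A} {p} {t} PA can@(_ , free , st) = record
    { wf = WF-∷ {A} {p} {t} free (wf PA)
    ; stable = st
    ; ⊆F = incl
    ; seed⊆ = λ {q} s → trans (at-there A (p≢ s)) (seed⊆ PA s)
    }
    where
    incl : ∀ {q s} → at ((p , t) ∷ A) q ≡ just s → at F q ≡ just s
    incl {q} eq with p ≟P q
    ... | yes refl = trans (attach⇒F PA can) eq
    ... | no _ = ⊆F PA eq
    p≢ : ∀ {q} → isSeed q ≡ true → p ≢ q
    p≢ s refl with () ← trans (sym s) (free⇒nonseed PA free (attach⇒F PA can))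

  producible⇒partial : ∀ {A} → Producible T τ Sd A → Partial A
  producible⇒partial (seed wfA A≈) = partial-≈ wfA A≈ partial-seed
  producible⇒partial (step {A} {B} prod can wfB B≈) =
    partial-≈ wfB B≈ (partial-∷ (producible⇒partial prod) can)

  producible-≈ : ∀ {A B} → WF B → B ≈A A → Producible T τ Sd A → Producible T τ Sd B
  producible-≈ {A} {B} wfB B≈A (seed _ A≈) = seed wfB (≈A-trans {B} {A} {Sd} B≈A A≈)
  producible-≈ {A} {B} wfB B≈A (step {A′} {p = p} {t} prod can _ A≈) =
    step prod can wfB (≈A-trans {B} {A} {(p , t) ∷ A′} B≈A A≈)

  at-++ : ∀ {A} es → (∀ {e} → e ∈ es → at A (proj₁ e) ≡ nothing) →
    ∀ {p t} → at A p ≡ just t → at (es ++ A) p ≡ just t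
  at-++ [] free eq = eq
  at-++ {A} (e ∷ es) free {p} eq = trans (at-there (es ++ A) e≢p) (at-++ es (free ∘ there) eq)
    where
    e≢p : proj₁ e ≢ p
    e≢p refl with () ← trans (sym eq) (free (here refl))

  Attachable : Assembly → Pos × Tile → Set
  Attachable A (p , t) = at A p ≡ nothing × τ ≤ attraction (at A) p t

  attachable? : ∀ A → Decidable (Attachable A)
  attachable? A (p , t) = nothing? (at A p) ×-dec (τ ≤? attraction (at A) p t)

  -- Attraction only grows, so tiles that are attachable to A simultaneously can be attached one
  -- after the other. This makes a parallel step a sequence of single attachments.
  attach-all : ∀ {A} es → WF es → (∀ {e} → e ∈ es → at F (proj₁ e) ≡ just (proj₂ e) × Attachable A e) →
    Producible T τ Sd A → Producible T τ Sd (es ++ A)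
  attach-all [] _ _ prod = prod
  attach-all {A} ((p , t) ∷ es) (p∉ ∷ wfes) ok prod = step rest
      (attach PB free (proj₁ (ok (here refl)))
        (≤-trans (proj₂ (proj₂ (ok (here refl)))) (attraction-mono (at A) (at (es ++ A)) (at-++ es (proj₁ ∘ proj₂ ∘ ok ∘ there)) p t)))
      (WF-∷ {es ++ A} {p} {t} free (wf PB)) (λ _ → refl)
    where
    rest = attach-all es wfes (ok ∘ there) prod
    PB = producible⇒partial rest
    free : at (es ++ A) p ≡ nothing
    free with at (es ++ A) p in eq
    ... | nothing = refl
    ... | just s with ∈-++⁻ es (at⇒∈ (es ++ A) eq)
    ...   | inj₁ p∈es = contradiction refl (All.lookup p∉ (∈-map⁺ proj₁ p∈es))
    ...   | inj₂ p∈A with () ← trans (sym (proj₁ (proj₂ (ok (here refl))))) (∈⇒at (Producible-WF prod) p∈A)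

  fresh : Assembly → Assembly
  fresh A = filter (attachable? A) F

  fresh⁻ : ∀ {A e} → e ∈ fresh A → at F (proj₁ e) ≡ just (proj₂ e) × Attachable A e
  fresh⁻ {A} e∈ with e∈F , ok ← ∈-filter⁻ (attachable? A) {xs = F} e∈ = ∈⇒at F-wf e∈F , ok

  parallel : Assembly → Assembly
  parallel A = fresh A ++ A

  producible-parallel : ∀ {A} → Producible T τ Sd A → Producible T τ Sd (parallel A)
  producible-parallel {A} = attach-all (fresh A) (WF-filter (attachable? A) F-wf) (fresh⁻ {A})

  parStep : ∀ {A} → Producible T τ Sd A → ParStep T τ A (parallel A)
  parStep {A} prod = (λ _ _ → at-++ (fresh A) (proj₁ ∘ proj₂ ∘ fresh⁻ {A})) , new , old
    where
    PA = producible⇒partial prod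
    wf′ = Producible-WF (producible-parallel prod)
    new : ∀ p t → CanAttach T τ A p t → at (parallel A) p ≡ just t
    new p t can@(_ , free , st) = ∈⇒at wf′ (∈-++⁺ˡ (∈-filter⁺ (attachable? A) (at⇒∈ F (attach⇒F PA can))
      (free , attach-needs {A = A} free (proj₂ (occupied PA)) st)))
    old : ∀ p t → at (parallel A) p ≡ just t → (at A p ≡ just t) ⊎ CanAttach T τ A p t
    old p t eq with ∈-++⁻ (fresh A) (at⇒∈ (parallel A) eq)
    ... | inj₂ p∈A = inj₁ (∈⇒at (wf PA) p∈A)
    ... | inj₁ p∈ with Fp , free , τ≤ ← fresh⁻ {A} p∈ = inj₂ (attach PA free Fp τ≤)

  run : ℕ → Assembly
  run zero = Sd
  run (suc i) = parallel (run i)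

  producible-run : ∀ i → Producible T τ Sd (run i)
  producible-run zero = seed Sd-wf (λ _ → refl)
  producible-run (suc i) = producible-parallel (producible-run i)

  run-partial : ∀ i → Partial (run i)
  run-partial i = producible⇒partial (producible-run i)

  ready : ∀ {A} → Partial A → ∀ {p t} → at F p ≡ just t → isSeed p ≡ false →
    (∀ {q s} → at F q ≡ just s → time q < time p → at A q ≡ just s) → τ ≤ attraction (at A) p t
  ready {A} PA Fp ns earlier = progress Fp ns (at A) agree
    where
    agree : ∀ q → isSeed q ≡ true ⊎ time q < time _ → at A q ≡ at F q
    agree q (inj₁ s) = seed⊆ PA s
    agree q (inj₂ lt) with at F q in Fq
    ... | just s = earlier Fq lt
    ... | nothing with at A q in Aq
    ...   | nothing = refl
    ...   | just s with () ← trans (sym Fq) (⊆F PA Aq)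

  -- A tile of time m is present after m + 1 parallel steps: whatever it relies on is static or has
  -- smaller time, hence is present one step earlier.
  run-reaches : ∀ i {p t} → at F p ≡ just t → isSeed p ≡ true ⊎ time p < i → at (run i) p ≡ just t
  run-reaches i Fp (inj₁ s) = trans (seed⊆ (run-partial i) s) Fp
  run-reaches (suc i) {p} {t} Fp (inj₂ (s≤s lt)) with at (run i) p in eq
  ... | just s = trans (proj₁ (parStep (producible-run i)) p s eq) (trans (sym (⊆F (run-partial i) eq)) Fp)
  ... | nothing = proj₁ (proj₂ (parStep (producible-run i))) p t (attach (run-partial i) eq Fp
      (ready (run-partial i) Fp (free⇒nonseed (run-partial i) eq Fp)
        (λ Fq q<p → run-reaches i Fq (inj₂ (ℕ.<-≤-trans q<p lt)))))

  -- Strong induction on `time`: a missing tile of least time would have everything it relies on in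
  -- A and could attach.
  terminal⇒F : ∀ {A} → Partial A → Terminal T τ A → A ≈A F
  terminal⇒F {A} PA term p with at F p in Fp
  ... | just t = <-rec (λ n → ∀ {p t} → time p ≡ n → at F p ≡ just t → at A p ≡ just t) arrive (time p) refl Fp
    where
    arrive : ∀ n → (∀ {m} → m < n → ∀ {p t} → time p ≡ m → at F p ≡ just t → at A p ≡ just t) →
      ∀ {p t} → time p ≡ n → at F p ≡ just t → at A p ≡ just t
    arrive n rec {p} {t} refl Fp with at A p in eq
    ... | just s = trans (sym (⊆F PA eq)) Fp
    ... | nothing = contradiction (attach PA eq Fp (ready PA Fp (free⇒nonseed PA eq Fp) (λ Fq lt → rec lt refl Fq)))
                      (term p t)
  ... | nothing with at A p in Ap
  ...   | nothing = refl
  ...   | just s with () ← trans (sym Fp) (⊆F PA Ap)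

  F⇒terminal : ∀ {A} → Partial A → A ≈A F → Terminal T τ A
  F⇒terminal PA A≈F p t can@(_ , free , _) with () ← trans (sym free) (trans (A≈F p) (attach⇒F PA can))

  -- `A ≈A F` ranges over all integer points. For partial assemblies this is an equivalent decidable
  -- condition, as the search by `least` requires.
  Full : Assembly → Set
  Full A = All (λ e → ¬ at A (proj₁ e) ≡ nothing) F

  full? : Decidable Full
  full? A = all? (λ e → ¬? (nothing? (at A (proj₁ e)))) F

  F⇒full : ∀ {A} → A ≈A F → Full A
  F⇒full {A} A≈F = All.tabulate (λ {e} e∈ free → just≢nothing (trans (sym (∈⇒at F-wf e∈)) (trans (sym (A≈F (proj₁ e))) free)))
    where
    just≢nothing : ∀ {t : Tile} → just t ≢ nothing
    just≢nothing ()

  full⇒F : ∀ {A} → Partial A → Full A → A ≈A F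
  full⇒F {A} PA full p with at A p in Ap
  ... | just t = sym (⊆F PA Ap)
  ... | nothing with at F p in Fp
  ...   | nothing = refl
  ...   | just t = contradiction Ap (All.lookup full (at⇒∈ F Fp))

  run-full : Full (run (suc D))
  run-full = All.tabulate missing
    where
    missing : ∀ {e} → e ∈ F → ¬ at (run (suc D)) (proj₁ e) ≡ nothing
    missing {p , t} e∈ free = contradiction (trans (sym free) (run-reaches (suc D) Fp (inj₂ (s≤s (time≤D Fp (free⇒nonseed (run-partial (suc D)) free Fp)))))) λ ()
      where
      Fp = ∈⇒at F-wf e∈

  assembles : UniquelyAssembles T τ Sd F
  assembles = producible-≈ F-wf (≈A-sym {run (suc D)} {F} (full⇒F (run-partial (suc D)) run-full)) (producible-run (suc D))
    , F⇒terminal (producible⇒partial F-producible) (λ _ → refl)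
    , λ B prod term → terminal⇒F (producible⇒partial prod) term
    where
    F-producible : Producible T τ Sd F
    F-producible = producible-≈ F-wf (≈A-sym {run (suc D)} {F} (full⇒F (run-partial (suc D)) run-full)) (producible-run (suc D))

  -- Full and terminal coincide for partial assemblies, so the first full index m, at most D + 1, is
  -- the first terminal one. `RunTime` counts assemblies instead of steps, which adds one more.
  runTime : ∃[ k ] RunTime T τ Sd k × k ≤ suc (suc D)
  runTime with m , m≤ , full , min ← least (full? ∘ run) (suc D) run-full
    = suc m
    , (run , (λ i _ → wf (run-partial i)) , (λ _ → refl) , (λ i _ → parStep (producible-run i))
      , F⇒terminal (run-partial m) (full⇒F (run-partial m) full)
      , λ i i<m term → min i i<m (F⇒full {run i} (terminal⇒F (run-partial i) term)))
    , s≤s m≤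

-- The tile set and the columns of the adder

-- At temperature 2 a glue of strength 2 binds alone and a glue of strength 1 needs a second side.
-- `kill` and `generate` thus fix the outgoing carry at once, whereas `propagate` has to cooperate
-- with `relay`.
blank chain pillar post anchor hook kill generate propagate : Glue
blank     = glue 0 0
chain     = glue 1 2
pillar    = glue 2 2
post      = glue 3 2
anchor    = glue 4 1
hook      = glue 5 1
kill      = glue 6 2
generate  = glue 7 2
propagate = glue 8 1

bit : Bool → ℕ
bit b = if b then 1 else 0

value carry relay parity partial-sum : Bool → Glue
value b       = glue (10 + bit b) 1
carry b       = glue (12 + bit b) 1
relay b       = glue (14 + bit b) 1
parity b      = glue (16 + bit b) 1
partial-sum b = glue (18 + bit b) 1

pair state : Bool → Bool → Glue
pair a b  = glue (20 + (2 * bit a + bit b)) 2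
state c p = glue (24 + (2 * bit c + bit p)) 2

-- North and west show the bit, south and east only hold the tile.  Post alone holds an input bit,
-- whereas anchor holds an output bit only together with a matching value.
bitT : Bool → Tile
bitT b = tile (value b) anchor post (value b) (bit b)

-- `start₄` supplies the initial carry 0. `zeroParity` imitates a pair of equal bits beyond the last
-- one, so the final carry becomes the top output bit by the usual `merge`, `sumT` and `emitT`.
foot ground stump rail corner bracket hanger ledge zeroParity start₁ start₄ pillarT end₁ end₅ end₇ : Tile
foot       = tile post chain blank chain 2
ground     = tile blank chain blank chain 2
stump      = tile post blank post blank 2
rail       = tile blank chain hook chain 2
corner     = tile blank chain pillar chain 2
bracket    = tile pillar blank pillar anchor 2
hanger     = tile pillar blank hook chain 2
ledge      = tile blank chain blank blank 2
zeroParity = tile (parity false) blank post blank 2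
start₁     = tile pillar chain blank blank 2
start₄     = tile blank (carry false) pillar blank 2
pillarT    = tile pillar blank pillar blank 2
end₁       = tile pillar blank blank chain 2
end₅       = tile pillar blank pillar chain 2
end₇       = tile blank blank pillar chain 2

combine : Bool → Bool → Tile
combine a b = tile (if a xor b then propagate else if a then generate else kill) (value b) (value a) (pair a b) 2

parityT : Bool → Bool → Tile
parityT a b = tile (parity (a xor b)) (pair a b) blank blank 2

-- The east side is blank for p = false: otherwise it could, together with the next carry, attract a
-- propagating carryT to the place of a non-propagating one.
merge : Bool → Bool → Tile
merge c p = tile (state c p) (if p then relay c else blank) (parity p) (carry c) 2

carryT : Bool → Bool → Bool → Tile
carryT a b c = if a xor b then tile blank (carry c) propagate (relay c) 2
               else tile blank (carry a) (if a then generate else kill) blank 2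

passT : Bool → Tile
passT c = tile hook (carry c) blank (carry c) 2

sumT : Bool → Bool → Tile
sumT c p = tile (partial-sum (p xor c)) blank (state c p) blank 2

emitT : Bool → Tile
emitT s = tile hook (value s) (partial-sum s) blank 2

bools² : (Bool → Bool → Tile) → List Tile
bools² f = f true true ∷ f true false ∷ f false true ∷ f false false ∷ []

-- Four tiles cover all eight instances of `carryT`: it is symmetric in a and b, and for a = b both
-- values of c give the same tile.
tileSet : TileSet
tileSet = bitT false ∷ bitT true ∷
  foot ∷ ground ∷ stump ∷ rail ∷ corner ∷ bracket ∷ hanger ∷ ledge ∷ zeroParity ∷
  start₁ ∷ start₄ ∷ pillarT ∷ end₁ ∷ end₅ ∷ end₇ ∷
  bools² combine ++ bools² parityT ++ bools² merge ++ bools² sumT ++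
  carryT true true true ∷ carryT false false true ∷ carryT true false true ∷ carryT true false false ∷
  passT true ∷ passT false ∷ emitT true ∷ emitT false ∷ []

majority : Bool → Bool → Bool → Bool
majority a b c = if a xor b then c else a

delay : Bool → Bool → ℕ → ℕ
delay a b d = if a xor b then suc d else 0

-- The tiles of the columns M, C and W of one bit (the static ones are marked by a star):
--
--   7   rail *     rail *      corner *
--   6   emitT      output      bracket *
--   5   sumT       ledge *     hanger *
--   4   merge      carryT      passT
--   3   parityT    combine     input b *
--   2              input a *   stump *
--   1   ground *   foot *      foot *
--
-- c is the carry entering the bit, and d the number of bits immediately before it that wait.
data Col : Set where
  ∅ start endW : Col
  colM colC colW : (a b c : Bool) (d : ℕ) → Col
  endM endC : (c : Bool) (d : ℕ) → Col

-- frame factors through skeleton, hence the template does not depend on the input.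
skeleton : Col → Col
skeleton (colM _ _ _ _) = colM false false false 0
skeleton (colC _ _ _ _) = colC false false false 0
skeleton (colW _ _ _ _) = colW false false false 0
skeleton (endM _ _) = endM false 0
skeleton (endC _ _) = endC false 0
skeleton k = k

skeletonFrame : Col → ℕ → Maybe Tile
skeletonFrame start 1 = just start₁
skeletonFrame start 2 = just pillarT
skeletonFrame start 3 = just pillarT
skeletonFrame start 4 = just start₄
skeletonFrame start 7 = just ledge
skeletonFrame (colM _ _ _ _) 1 = just ground
skeletonFrame (colM _ _ _ _) 7 = just rail
skeletonFrame (colC _ _ _ _) 1 = just foot
skeletonFrame (colC _ _ _ _) 5 = just ledge
skeletonFrame (colC _ _ _ _) 7 = just rail
skeletonFrame (colW _ _ _ _) 1 = just foot
skeletonFrame (colW _ _ _ _) 2 = just stump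
skeletonFrame (colW _ _ _ _) 5 = just hanger
skeletonFrame (colW _ _ _ _) 6 = just bracket
skeletonFrame (colW _ _ _ _) 7 = just corner
skeletonFrame (endM _ _) 1 = just foot
skeletonFrame (endM _ _) 2 = just stump
skeletonFrame (endM _ _) 3 = just zeroParity
skeletonFrame (endM _ _) 7 = just rail
skeletonFrame (endC _ _) 1 = just ground
skeletonFrame (endC _ _) 5 = just ledge
skeletonFrame (endC _ _) 7 = just rail
skeletonFrame endW 1 = just end₁
skeletonFrame endW 2 = just pillarT
skeletonFrame endW 3 = just pillarT
skeletonFrame endW 4 = just pillarT
skeletonFrame endW 5 = just end₅
skeletonFrame endW 6 = just bracket
skeletonFrame endW 7 = just end₇
skeletonFrame _ _ = nothing

frame : Col → ℕ → Maybe Tile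
frame k = skeletonFrame (skeleton k)

input : Col → ℕ → Maybe Bool
input (colC a _ _ _) 2 = just a
input (colW _ b _ _) 3 = just b
input _ _ = nothing

grown : Col → ℕ → Maybe Tile
grown (colM a b c _) 3 = just (parityT a b)
grown (colM a b c _) 4 = just (merge c (a xor b))
grown (colM a b c _) 5 = just (sumT c (a xor b))
grown (colM a b c _) 6 = just (emitT ((a xor b) xor c))
grown (colC a b c _) 3 = just (combine a b)
grown (colC a b c _) 4 = just (carryT a b c)
grown (colC a b c _) 6 = just (bitT ((a xor b) xor c))
grown (colW a b c _) 4 = just (passT (majority a b c))
grown (endM c _) 4 = just (merge c false)
grown (endM c _) 5 = just (sumT c false)
grown (endM c _) 6 = just (emitT c)
grown (endC c _) 6 = just (bitT c)
grown _ _ = nothing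

content : Col → ℤ → Maybe Tile
content k (ℤ.+ y) = frame k y <∣> (Maybe.map bitT (input k y) <∣> grown k y)
content k -[1+ _ ] = nothing

isStatic : Col → ℤ → Bool
isStatic k (ℤ.+ y) = is-just (frame k y) ∨ is-just (input k y)
isStatic k -[1+ _ ] = false

-- Written in the nesting to which `attraction` reduces, so the two agree definitionally.
localAttraction : (n e s w : Maybe Tile) → Tile → ℕ
localAttraction n e s w t = bond? N t n + (bond? E t e + (bond? S t s + (bond? W t w + 0)))

eqGlue : Glue → Glue → Bool
eqGlue (glue a b) (glue c d) = (a ≡ᵇ c) ∧ (b ≡ᵇ d)

eqTile : Tile → Tile → Bool
eqTile (tile n e s w l) (tile n′ e′ s′ w′ l′) =
  eqGlue n n′ ∧ (eqGlue e e′ ∧ (eqGlue s s′ ∧ (eqGlue w w′ ∧ (l ≡ᵇ l′))))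

is : Maybe Tile → Tile → Bool
is nothing  t = false
is (just s) t = eqTile s t

-- A schedule giving upper bounds: every tile comes strictly after the grown neighbours through
-- which it binds. A waiting bit costs three steps, for its `carryT`, its `passT` and the next
-- `merge`.
time : Col → ℤ → ℕ
time (colM _ _ _ _) (ℤ.+ 3) = 2
time (colM _ _ _ d) (ℤ.+ 4) = 4 + d * 3
time (colM _ _ _ d) (ℤ.+ 5) = 5 + d * 3
time (colM _ _ _ d) (ℤ.+ 6) = 6 + d * 3
time (colC _ _ _ _) (ℤ.+ 3) = 1
time (colC a b _ d) (ℤ.+ 4) = if a xor b then 5 + d * 3 else 2
time (colC _ _ _ d) (ℤ.+ 6) = 7 + d * 3
time (colW a b _ d) (ℤ.+ 4) = if a xor b then 6 + d * 3 else 3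
time (endM _ d) (ℤ.+ 4) = 4 + d * 3
time (endM _ d) (ℤ.+ 5) = 5 + d * 3
time (endM _ d) (ℤ.+ 6) = 6 + d * 3
time (endC _ d) (ℤ.+ 6) = 7 + d * 3
time _ _ = 0

-- Adjacent columns and the finite check of soundness

data Feeds : Col → Bool → ℕ → Set where
  start : Feeds start false 0
  colW  : ∀ {a b c d} → Feeds (colW a b c d) (majority a b c) (delay a b d)

data Takes : Col → Bool → ℕ → Set where
  colM : ∀ {a b c d} → Takes (colM a b c d) c d
  endM : ∀ {c d} → Takes (endM c d) c d

-- The patterns of three adjacent columns. `Feeds` and `Takes` match carry and run length across the
-- border between two bits, so that the check meets only consistent triples.
data Consecutive : Col → Col → Col → Set where
  outside  : Consecutive ∅ ∅ ∅
  before   : Consecutive ∅ ∅ start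
  atStart  : ∀ {R} → Takes R false 0 → Consecutive ∅ start R
  atM      : ∀ {L a b c d} → Feeds L c d → Consecutive L (colM a b c d) (colC a b c d)
  atC      : ∀ {a b c d} → Consecutive (colM a b c d) (colC a b c d) (colW a b c d)
  atW      : ∀ {R a b c d} → Takes R (majority a b c) (delay a b d) → Consecutive (colC a b c d) (colW a b c d) R
  atEndM   : ∀ {L c d} → Feeds L c d → Consecutive L (endM c d) (endC c d)
  atEndC   : ∀ {c d} → Consecutive (endM c d) (endC c d) endW
  atEndW   : ∀ {c d} → Consecutive (endC c d) endW ∅
  after    : Consecutive endW ∅ ∅

rowCheck : Col → Col → Col → ℤ → Bool
rowCheck L M R y = isStatic M y ∨ all (λ t →
  (localAttraction (content M (y ℤ.+ ℤ.+ 1)) (content R y) (content M (y ℤ.- ℤ.+ 1)) (content L y) t ≤ᵇ 1)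
  ∨ is (content M y) t) tileSet

-- The occupied rows 1 to 7 and one margin row on either side; farther out all four neighbours are
-- empty and `isolated` applies.
rows : List ℤ
rows = map ℤ.+_ (upTo 9)

check : Col → Col → Col → Bool
check L M R = all (rowCheck L M R) rows

∀ᵇ : (Bool → Bool) → Bool
∀ᵇ P = P true ∧ P false


∧-split : ∀ {x y} → x ∧ y ≡ true → x ≡ true × y ≡ true
∧-split {true} {true} _ = refl , refl

∀ᵇ-sound : ∀ P → ∀ᵇ P ≡ true → ∀ b → P b ≡ true
∀ᵇ-sound P eq true  = proj₁ (∧-split eq)
∀ᵇ-sound P eq false = proj₂ (∧-split {P true} eq)

∀ᵇ²-sound : ∀ (P : Bool → Bool → Bool) → (∀ᵇ λ a → ∀ᵇ λ b → P a b) ≡ true → ∀ a b → P a b ≡ true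
∀ᵇ²-sound P eq a = ∀ᵇ-sound (P a) (∀ᵇ-sound (λ a → ∀ᵇ (P a)) eq a)

∀ᵇ³-sound : ∀ (P : Bool → Bool → Bool → Bool) → (∀ᵇ λ a → ∀ᵇ λ b → ∀ᵇ λ c → P a b c) ≡ true → ∀ a b c → P a b c ≡ true
∀ᵇ³-sound P eq a = ∀ᵇ²-sound (P a) (∀ᵇ-sound (λ a → ∀ᵇ λ b → ∀ᵇ λ c → P a b c) eq a)

∀ᵇ⁵-sound : ∀ (P : Bool → Bool → Bool → Bool → Bool → Bool) → (∀ᵇ λ a → ∀ᵇ λ b → ∀ᵇ λ c → ∀ᵇ λ a′ → ∀ᵇ λ b′ → P a b c a′ b′) ≡ true →
  ∀ a b c a′ b′ → P a b c a′ b′ ≡ true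
∀ᵇ⁵-sound P eq a b = ∀ᵇ³-sound (P a b)
  (∀ᵇ²-sound (λ a b → ∀ᵇ λ c → ∀ᵇ λ a′ → ∀ᵇ λ b′ → P a b c a′ b′) eq a b)

-- The contents of a cell are computed from bits and carry alone, so the check evaluates with d left
-- as a variable. The Boolean parameters are gathered into one closed conjunction, settled by a
-- single `refl`.
consecutive-check : ∀ {L M R} → Consecutive L M R → check L M R ≡ true
consecutive-check outside = refl
consecutive-check before = refl
consecutive-check (atStart (colM {a} {b})) =
  ∀ᵇ²-sound (λ a b → check ∅ start (colM a b false 0)) refl a b
consecutive-check (atStart endM) = refl
consecutive-check (atM {a = a} {b} start) =
  ∀ᵇ²-sound (λ a b → check start (colM a b false 0) (colC a b false 0)) refl a b
consecutive-check (atM {a = a′} {b′} (colW {a} {b} {c} {d})) = ∀ᵇ⁵-sound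
  (λ a b c a′ b′ → check (colW a b c d) (colM a′ b′ (majority a b c) (delay a b d)) (colC a′ b′ (majority a b c) (delay a b d)))
  refl a b c a′ b′
consecutive-check (atC {a} {b} {c} {d}) =
  ∀ᵇ³-sound (λ a b c → check (colM a b c d) (colC a b c d) (colW a b c d)) refl a b c
consecutive-check (atW {a = a} {b} {c} {d} (colM {a′} {b′})) = ∀ᵇ⁵-sound
  (λ a b c a′ b′ → check (colC a b c d) (colW a b c d) (colM a′ b′ (majority a b c) (delay a b d)))
  refl a b c a′ b′
consecutive-check (atW {a = a} {b} {c} {d} endM) = ∀ᵇ³-sound
  (λ a b c → check (colC a b c d) (colW a b c d) (endM (majority a b c) (delay a b d))) refl a b c
consecutive-check (atEndM start) = refl
consecutive-check (atEndM (colW {a} {b} {c} {d})) = ∀ᵇ³-sound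
  (λ a b c → check (colW a b c d) (endM (majority a b c) (delay a b d)) (endC (majority a b c) (delay a b d))) refl a b c
consecutive-check (atEndC {c} {d}) = ∀ᵇ-sound (λ c → check (endM c d) (endC c d) endW) refl c
consecutive-check (atEndW {c} {d}) = ∀ᵇ-sound (λ c → check (endC c d) endW ∅) refl c
consecutive-check after = refl

eqGlue-sound : ∀ g h → eqGlue g h ≡ true → g ≡ h
eqGlue-sound (glue a b) (glue c d) eq with p , q ← ∧-split {a ≡ᵇ c} eq =
  cong₂ glue (ℕ.≡ᵇ⇒≡ a c (subst T (sym p) _)) (ℕ.≡ᵇ⇒≡ b d (subst T (sym q) _))

eqTile-sound : ∀ s t → eqTile s t ≡ true → s ≡ t
eqTile-sound (tile n e s w l) (tile n′ e′ s′ w′ l′) eq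
  with p₁ , eq₁ ← ∧-split {eqGlue n n′} eq
  with p₂ , eq₂ ← ∧-split {eqGlue e e′} eq₁
  with p₃ , eq₃ ← ∧-split {eqGlue s s′} eq₂
  with p₄ , p₅ ← ∧-split {eqGlue w w′} eq₃
  with refl ← eqGlue-sound n n′ p₁ | refl ← eqGlue-sound e e′ p₂ | refl ← eqGlue-sound s s′ p₃
     | refl ← eqGlue-sound w w′ p₄ | refl ← ℕ.≡ᵇ⇒≡ l l′ (subst T (sym p₅) _) = refl

is-sound : ∀ m t → is m t ≡ true → m ≡ just t
is-sound (just s) t eq = cong just (eqTile-sound s t eq)

all-sound : ∀ {A : Set} (P : A → Bool) xs → all P xs ≡ true → ∀ {x} → x ∈ xs → P x ≡ true
all-sound P (x ∷ xs) eq (here refl) = proj₁ (∧-split eq)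
all-sound P (x ∷ xs) eq (there x∈)  = all-sound P xs (proj₂ (∧-split {P x} eq)) x∈

content-bottom : ∀ k → content k (ℤ.+ 0) ≡ nothing
content-bottom ∅ = refl
content-bottom start = refl
content-bottom endW = refl
content-bottom (colM a b c d) = refl
content-bottom (colC a b c d) = refl
content-bottom (colW a b c d) = refl
content-bottom (endM c d) = refl
content-bottom (endC c d) = refl

content-top : ∀ k y → content k (ℤ.+ (8 + y)) ≡ nothing
content-top ∅ y = refl
content-top start y = refl
content-top endW y = refl
content-top (colM a b c d) y = refl
content-top (colC a b c d) y = refl
content-top (colW a b c d) y = refl
content-top (endM c d) y = refl
content-top (endC c d) y = refl

≤ᵇ-∨ : ∀ n {b} → (n ≤ᵇ 1) ∨ b ≡ true → 2 ≤ n → b ≡ true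
≤ᵇ-∨ (suc (suc n)) eq _ = eq
≤ᵇ-∨ (suc zero) _ (s≤s ())

rowCheck-sound : ∀ L M R y → rowCheck L M R y ≡ true → ∀ {t} → t ∈ tileSet → isStatic M y ≡ false →
  2 ≤ localAttraction (content M (y ℤ.+ ℤ.+ 1)) (content R y) (content M (y ℤ.- ℤ.+ 1)) (content L y) t →
  content M y ≡ just t
rowCheck-sound L M R y ok {t} t∈ ns le rewrite ns =
  is-sound (content M y) t (≤ᵇ-∨ _ (all-sound (λ t →
    (localAttraction (content M (y ℤ.+ ℤ.+ 1)) (content R y) (content M (y ℤ.- ℤ.+ 1)) (content L y) t ≤ᵇ 1)
    ∨ is (content M y) t) tileSet ok t∈) le)

isolated : ∀ {n e s w} t → n ≡ nothing → e ≡ nothing → s ≡ nothing → w ≡ nothing →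
  ∀ {ℓ} {B : Set ℓ} → 2 ≤ localAttraction n e s w t → B
isolated t refl refl refl refl ()

check-sound : ∀ {L M R} → Consecutive L M R → ∀ y {t} → t ∈ tileSet → isStatic M y ≡ false →
  2 ≤ localAttraction (content M (y ℤ.+ ℤ.+ 1)) (content R y) (content M (y ℤ.- ℤ.+ 1)) (content L y) t →
  content M y ≡ just t
check-sound {L} {M} {R} adj -[1+ zero ] {t} t∈ ns le = isolated t (content-bottom M) refl refl refl le
check-sound {L} {M} {R} adj -[1+ suc y ] {t} t∈ ns le = isolated t refl refl refl refl le
check-sound {L} {M} {R} adj (ℤ.+ y) {t} t∈ ns le with y ℕ.<? 9
... | yes y<9 = rowCheck-sound L M R (ℤ.+ y)
      (all-sound (rowCheck L M R) rows (consecutive-check adj) (∈-map⁺ ℤ.+_ (∈-upTo⁺ y<9))) t∈ ns le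
... | no y≮9 with k , refl ← ℕ.m≤n⇒∃[o]m+o≡n (ℕ.≮⇒≥ y≮9) =
      isolated t (content-top M (suc (k + 1))) (content-top R (suc k)) (content-top M k) (content-top L (suc k)) le

-- A view with one constructor per kind of grown cell, so that proofs about progress, timing and
-- membership skip all static and empty cells.
data Grown : Col → ℤ → Tile → Set where
  parityᵍ  : ∀ {a b c d} → Grown (colM a b c d) (ℤ.+ 3) (parityT a b)
  mergeᵍ   : ∀ {a b c d} → Grown (colM a b c d) (ℤ.+ 4) (merge c (a xor b))
  sumᵍ     : ∀ {a b c d} → Grown (colM a b c d) (ℤ.+ 5) (sumT c (a xor b))
  emitᵍ    : ∀ {a b c d} → Grown (colM a b c d) (ℤ.+ 6) (emitT ((a xor b) xor c))
  combineᵍ : ∀ {a b c d} → Grown (colC a b c d) (ℤ.+ 3) (combine a b)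
  carryᵍ   : ∀ {a b c d} → Grown (colC a b c d) (ℤ.+ 4) (carryT a b c)
  outputᵍ  : ∀ {a b c d} → Grown (colC a b c d) (ℤ.+ 6) (bitT ((a xor b) xor c))
  passᵍ    : ∀ {a b c d} → Grown (colW a b c d) (ℤ.+ 4) (passT (majority a b c))
  mergeᵉ   : ∀ {c d} → Grown (endM c d) (ℤ.+ 4) (merge c false)
  sumᵉ     : ∀ {c d} → Grown (endM c d) (ℤ.+ 5) (sumT c false)
  emitᵉ    : ∀ {c d} → Grown (endM c d) (ℤ.+ 6) (emitT c)
  outputᵉ  : ∀ {c d} → Grown (endC c d) (ℤ.+ 6) (bitT c)

grown-view : ∀ k y {t} → grown k y ≡ just t → Grown k (ℤ.+ y) t
grown-view (colM a b c d) 3 refl = parityᵍ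
grown-view (colM a b c d) 4 refl = mergeᵍ
grown-view (colM a b c d) 5 refl = sumᵍ
grown-view (colM a b c d) 6 refl = emitᵍ
grown-view (colC a b c d) 3 refl = combineᵍ
grown-view (colC a b c d) 4 refl = carryᵍ
grown-view (colC a b c d) 6 refl = outputᵍ
grown-view (colW a b c d) 4 refl = passᵍ
grown-view (endM c d) 4 refl = mergeᵉ
grown-view (endM c d) 5 refl = sumᵉ
grown-view (endM c d) 6 refl = emitᵉ
grown-view (endC c d) 6 refl = outputᵉ

content-view : ∀ k y {t} → content k y ≡ just t → isStatic k y ≡ false → Grown k y t
content-view k (ℤ.+ y) eq ns with frame k y | input k y
... | nothing | nothing = grown-view k y eq
content-view k (ℤ.+ y) eq () | nothing | just _
content-view k (ℤ.+ y) eq () | just _  | _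

-- Local progress

≡ᵇ-refl : ∀ n → (n ≡ᵇ n) ≡ true
≡ᵇ-refl zero = refl
≡ᵇ-refl (suc n) = ≡ᵇ-refl n

glueStr-refl : ∀ g → glueStr g g ≡ strength g
glueStr-refl g rewrite ≡ᵇ-refl (gtype g) | ≡ᵇ-refl (strength g) = refl

matches : ∀ {k} g → k ≤ strength g → k ≤ glueStr g g
matches g = subst (_ ≤_) (sym (glueStr-refl g))

localAttraction-≥ : ∀ n e s w t i j k l → i ≤ bond? N t n → j ≤ bond? E t e → k ≤ bond? S t s → l ≤ bond? W t w →
  i + (j + (k + (l + 0))) ≤ localAttraction n e s w t
localAttraction-≥ n e s w t i j k l pi pj pk pl = +-mono-≤ pi (+-mono-≤ pj (+-mono-≤ pk (+-mono-≤ pl z≤n)))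

via : ∀ {k m m′} d t → m ≡ m′ → k ≤ bond? d t m′ → k ≤ bond? d t m
via d t refl le = le

-- In both branches of `delay` the `passT` is scheduled exactly one step before the `merge` it
-- feeds; at the left border the carry tile belongs to the seed.
fed : ∀ {L c d} → Feeds L c d → ∀ p {w} →
  (isStatic L (ℤ.+ 4) ≡ true ⊎ time L (ℤ.+ 4) < 4 + d * 3 → w ≡ content L (ℤ.+ 4)) → 1 ≤ bond? W (merge c p) w
fed start p hw = via W (merge false p) (hw (inj₁ refl)) ≤-refl
fed (colW {a} {b} {c} {d}) p hw = via W (merge (majority a b c) p) (hw (inj₂ (earlier a b)))
  (matches (carry (majority a b c)) ≤-refl)
  where
  earlier : ∀ a b → (if a xor b then 6 + d * 3 else 3) < 4 + delay a b d * 3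
  earlier true true = ≤-refl
  earlier true false = ≤-refl
  earlier false true = ≤-refl
  earlier false false = ≤-refl

-- The four numbers given to `localAttraction-≥` are the bonds demanded on N, E, S and W. They sum
-- to 2, and a side whose neighbour may come later is credited with 0.
local-progress : ∀ {L M R} → Consecutive L M R → ∀ {y t} → Grown M y t → ∀ n e s w →
  (isStatic M (y ℤ.+ ℤ.+ 1) ≡ true ⊎ time M (y ℤ.+ ℤ.+ 1) < time M y → n ≡ content M (y ℤ.+ ℤ.+ 1)) →
  (isStatic R y ≡ true ⊎ time R y < time M y → e ≡ content R y) →
  (isStatic M (y ℤ.- ℤ.+ 1) ≡ true ⊎ time M (y ℤ.- ℤ.+ 1) < time M y → s ≡ content M (y ℤ.- ℤ.+ 1)) →
  (isStatic L y ≡ true ⊎ time L y < time M y → w ≡ content L y) →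
  2 ≤ localAttraction n e s w t
local-progress (atM _) (parityᵍ {a} {b}) n e s w hn he hs hw =
  localAttraction-≥ n e s w (parityT a b) 0 2 0 0 z≤n (via E (parityT a b) (he (inj₂ ≤-refl)) (matches (pair a b) ≤-refl)) z≤n z≤n
local-progress (atM feeds) (mergeᵍ {a} {b} {c} {d}) n e s w hn he hs hw =
  localAttraction-≥ n e s w t 0 0 1 1 z≤n z≤n
    (via S t (hs (inj₂ (s≤s (s≤s (s≤s z≤n))))) (matches (parity (a xor b)) ≤-refl)) (fed feeds (a xor b) hw)
  where t = merge c (a xor b)
local-progress (atM _) (sumᵍ {a} {b} {c}) n e s w hn he hs hw =
  localAttraction-≥ n e s w (sumT c (a xor b)) 0 0 2 0 z≤n z≤n (via S (sumT c (a xor b)) (hs (inj₂ ≤-refl)) (matches (state c (a xor b)) ≤-refl)) z≤n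
local-progress (atM _) (emitᵍ {a} {b} {c}) n e s w hn he hs hw =
  localAttraction-≥ n e s w t 1 0 1 0 (via N t (hn (inj₁ refl)) ≤-refl) z≤n
    (via S t (hs (inj₂ ≤-refl)) (matches (partial-sum ((a xor b) xor c)) ≤-refl)) z≤n
  where t = emitT ((a xor b) xor c)
local-progress atC (combineᵍ {a} {b}) n e s w hn he hs hw =
  localAttraction-≥ n e s w (combine a b) 0 1 1 0 z≤n (via E (combine a b) (he (inj₁ refl)) (matches (value b) ≤-refl))
    (via S (combine a b) (hs (inj₁ refl)) (matches (value a) ≤-refl)) z≤n
local-progress atC (carryᵍ {true} {true} {c}) n e s w hn he hs hw =
  localAttraction-≥ n e s w (carryT true true c) 0 0 2 0 z≤n z≤n (via S (carryT true true c) (hs (inj₂ ≤-refl)) ≤-refl) z≤n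
local-progress atC (carryᵍ {false} {false} {c}) n e s w hn he hs hw =
  localAttraction-≥ n e s w (carryT false false c) 0 0 2 0 z≤n z≤n (via S (carryT false false c) (hs (inj₂ ≤-refl)) ≤-refl) z≤n
local-progress atC (carryᵍ {true} {false} {c}) n e s w hn he hs hw =
  localAttraction-≥ n e s w (carryT true false c) 0 0 1 1 z≤n z≤n (via S (carryT true false c) (hs (inj₂ (s≤s (s≤s z≤n)))) ≤-refl)
    (via W (carryT true false c) (hw (inj₂ ≤-refl)) (matches (relay c) ≤-refl))
local-progress atC (carryᵍ {false} {true} {c}) n e s w hn he hs hw =
  localAttraction-≥ n e s w (carryT false true c) 0 0 1 1 z≤n z≤n (via S (carryT false true c) (hs (inj₂ (s≤s (s≤s z≤n)))) ≤-refl)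
    (via W (carryT false true c) (hw (inj₂ ≤-refl)) (matches (relay c) ≤-refl))
local-progress atC (outputᵍ {a} {b} {c}) n e s w hn he hs hw =
  localAttraction-≥ n e s w t 0 1 0 1 z≤n (via E t (he (inj₁ refl)) ≤-refl) z≤n
    (via W t (hw (inj₂ ≤-refl)) (matches (value ((a xor b) xor c)) ≤-refl))
  where t = bitT ((a xor b) xor c)
local-progress (atW _) (passᵍ {a} {b} {c} {d}) n e s w hn he hs hw =
  localAttraction-≥ n e s w t 1 0 0 1 (via N t (hn (inj₁ refl)) ≤-refl) z≤n z≤n (via W t (hw (inj₂ (lt a b))) (link a b))
  where
  t = passT (majority a b c)
  lt : ∀ a b → (if a xor b then 5 + d * 3 else 2) < (if a xor b then 6 + d * 3 else 3)
  lt true true = ≤-refl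
  lt true false = ≤-refl
  lt false true = ≤-refl
  lt false false = ≤-refl
  link : ∀ a b → 1 ≤ bond W (passT (majority a b c)) (carryT a b c)
  link true true = ≤-refl
  link true false = matches (carry c) ≤-refl
  link false true = matches (carry c) ≤-refl
  link false false = ≤-refl
local-progress (atEndM feeds) (mergeᵉ {c} {d}) n e s w hn he hs hw =
  localAttraction-≥ n e s w (merge c false) 0 0 1 1 z≤n z≤n (via S (merge c false) (hs (inj₁ refl)) ≤-refl) (fed feeds false hw)
local-progress (atEndM _) (sumᵉ {c}) n e s w hn he hs hw =
  localAttraction-≥ n e s w (sumT c false) 0 0 2 0 z≤n z≤n (via S (sumT c false) (hs (inj₂ ≤-refl)) (matches (state c false) ≤-refl)) z≤n
local-progress (atEndM _) (emitᵉ {c}) n e s w hn he hs hw =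
  localAttraction-≥ n e s w (emitT c) 1 0 1 0 (via N (emitT c) (hn (inj₁ refl)) ≤-refl) z≤n
    (via S (emitT c) (hs (inj₂ ≤-refl)) (matches (partial-sum c) ≤-refl)) z≤n
local-progress atEndC (outputᵉ {c}) n e s w hn he hs hw =
  localAttraction-≥ n e s w (bitT c) 0 1 0 1 z≤n (via E (bitT c) (he (inj₁ refl)) ≤-refl) z≤n
    (via W (bitT c) (hw (inj₂ ≤-refl)) (matches (value c) ≤-refl))

waiting : Col → ℕ
waiting (colM _ _ _ d) = d
waiting (colC _ _ _ d) = d
waiting (colW _ _ _ d) = d
waiting (endM _ d) = d
waiting (endC _ d) = d
waiting _ = 0

time≤ : ∀ {k y t} → Grown k y t → time k y ≤ 7 + waiting k * 3
time≤ parityᵍ = s≤s (s≤s z≤n)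
time≤ mergeᵍ = +-monoˡ-≤ _ (s≤s (s≤s (s≤s (s≤s z≤n))))
time≤ sumᵍ = +-monoˡ-≤ _ (s≤s (s≤s (s≤s (s≤s (s≤s z≤n)))))
time≤ emitᵍ = +-monoˡ-≤ _ (s≤s (s≤s (s≤s (s≤s (s≤s (s≤s z≤n))))))
time≤ combineᵍ = s≤s z≤n
time≤ (carryᵍ {a} {b}) with a xor b
... | true = +-monoˡ-≤ _ (s≤s (s≤s (s≤s (s≤s (s≤s z≤n)))))
... | false = s≤s (s≤s z≤n)
time≤ outputᵍ = ≤-refl
time≤ (passᵍ {a} {b}) with a xor b
... | true = +-monoˡ-≤ _ (s≤s (s≤s (s≤s (s≤s (s≤s (s≤s z≤n))))))
... | false = s≤s (s≤s (s≤s z≤n))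
time≤ mergeᵉ = +-monoˡ-≤ _ (s≤s (s≤s (s≤s (s≤s z≤n))))
time≤ sumᵉ = +-monoˡ-≤ _ (s≤s (s≤s (s≤s (s≤s (s≤s z≤n)))))
time≤ emitᵉ = +-monoˡ-≤ _ (s≤s (s≤s (s≤s (s≤s (s≤s (s≤s z≤n))))))
time≤ outputᵉ = ≤-refl

any-sound : ∀ t xs → any (eqTile t) xs ≡ true → t ∈ xs
any-sound t (x ∷ xs) eq with eqTile t x in p
... | true = here (eqTile-sound t x p)
... | false = there (any-sound t xs eq)

available : Tile → Bool
available t = any (eqTile t) tileSet

available-sound : ∀ t → available t ≡ true → t ∈ tileSet
available-sound t = any-sound t tileSet

grown∈ : ∀ {k y t} → Grown k y t → t ∈ tileSet
grown∈ (parityᵍ {a} {b}) = available-sound _ (∀ᵇ²-sound (λ a b → available (parityT a b)) refl a b)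
grown∈ (mergeᵍ {a} {b} {c}) = available-sound _ (∀ᵇ²-sound (λ c p → available (merge c p)) refl c (a xor b))
grown∈ (sumᵍ {a} {b} {c}) = available-sound _ (∀ᵇ²-sound (λ c p → available (sumT c p)) refl c (a xor b))
grown∈ (emitᵍ {a} {b} {c}) = available-sound _ (∀ᵇ-sound (λ s → available (emitT s)) refl ((a xor b) xor c))
grown∈ (combineᵍ {a} {b}) = available-sound _ (∀ᵇ²-sound (λ a b → available (combine a b)) refl a b)
grown∈ (carryᵍ {a} {b} {c}) = available-sound _ (∀ᵇ³-sound (λ a b c → available (carryT a b c)) refl a b c)
grown∈ (outputᵍ {a} {b} {c}) = available-sound _ (∀ᵇ-sound (λ s → available (bitT s)) refl ((a xor b) xor c))
grown∈ (passᵍ {a} {b} {c}) = available-sound _ (∀ᵇ-sound (λ s → available (passT s)) refl (majority a b c))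
grown∈ (mergeᵉ {c}) = available-sound _ (∀ᵇ-sound (λ c → available (merge c false)) refl c)
grown∈ (sumᵉ {c}) = available-sound _ (∀ᵇ-sound (λ c → available (sumT c false)) refl c)
grown∈ (emitᵉ {c}) = available-sound _ (∀ᵇ-sound (λ c → available (emitT c)) refl c)
grown∈ (outputᵉ {c}) = available-sound _ (∀ᵇ-sound (λ c → available (bitT c)) refl c)

usable : ∀ t → available t ≡ true → label t ≡ 2 → t ∈ tileSet × label t ≡ 2
usable t p q = available-sound t p , q

frame∈ : ∀ k y {t} → frame k y ≡ just t → t ∈ tileSet × label t ≡ 2
frame∈ start 1 refl = usable start₁ refl refl
frame∈ start 2 refl = usable pillarT refl refl
frame∈ start 3 refl = usable pillarT refl refl
frame∈ start 4 refl = usable start₄ refl refl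
frame∈ start 7 refl = usable ledge refl refl
frame∈ (colM _ _ _ _) 1 refl = usable ground refl refl
frame∈ (colM _ _ _ _) 7 refl = usable rail refl refl
frame∈ (colC _ _ _ _) 1 refl = usable foot refl refl
frame∈ (colC _ _ _ _) 5 refl = usable ledge refl refl
frame∈ (colC _ _ _ _) 7 refl = usable rail refl refl
frame∈ (colW _ _ _ _) 1 refl = usable foot refl refl
frame∈ (colW _ _ _ _) 2 refl = usable stump refl refl
frame∈ (colW _ _ _ _) 5 refl = usable hanger refl refl
frame∈ (colW _ _ _ _) 6 refl = usable bracket refl refl
frame∈ (colW _ _ _ _) 7 refl = usable corner refl refl
frame∈ (endM _ _) 1 refl = usable foot refl refl
frame∈ (endM _ _) 2 refl = usable stump refl refl
frame∈ (endM _ _) 3 refl = usable zeroParity refl refl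
frame∈ (endM _ _) 7 refl = usable rail refl refl
frame∈ (endC _ _) 1 refl = usable ground refl refl
frame∈ (endC _ _) 5 refl = usable ledge refl refl
frame∈ (endC _ _) 7 refl = usable rail refl refl
frame∈ endW 1 refl = usable end₁ refl refl
frame∈ endW 2 refl = usable pillarT refl refl
frame∈ endW 3 refl = usable pillarT refl refl
frame∈ endW 4 refl = usable pillarT refl refl
frame∈ endW 5 refl = usable end₅ refl refl
frame∈ endW 6 refl = usable bracket refl refl
frame∈ endW 7 refl = usable end₇ refl refl

-- The seed

-- c and d are the carry and the run length entering at column 0, so that recursion on bits advances
-- by three columns. The empty vectors leave a closing block for the overflow bit.
layout : ∀ {n} → Vec Bool n → Vec Bool n → Bool → ℕ → ℕ → Col
layout [] [] c d 0 = endM c d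
layout [] [] c d 1 = endC c d
layout [] [] c d 2 = endW
layout [] [] c d (suc (suc (suc _))) = ∅
layout (a ∷ as) (b ∷ bs) c d 0 = colM a b c d
layout (a ∷ as) (b ∷ bs) c d 1 = colC a b c d
layout (a ∷ as) (b ∷ bs) c d 2 = colW a b c d
layout (a ∷ as) (b ∷ bs) c d (suc (suc (suc x))) = layout as bs (majority a b c) (delay a b d) x

columnℕ : ∀ {n} → Vec Bool n → Vec Bool n → ℕ → Col
columnℕ as bs zero    = start
columnℕ as bs (suc x) = layout as bs false 0 x

column : ∀ {n} → Vec Bool n → Vec Bool n → ℤ → Col
column as bs (ℤ.+ x)  = columnℕ as bs x
column as bs -[1+ _ ] = ∅

layout-takes : ∀ {n} (as bs : Vec Bool n) c d → Takes (layout as bs c d 0) c d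
layout-takes [] [] c d = endM
layout-takes (_ ∷ _) (_ ∷ _) c d = colM

layout-first : ∀ {n L c d} (as bs : Vec Bool n) → Feeds L c d →
  Consecutive L (layout as bs c d 0) (layout as bs c d 1)
layout-first [] [] feeds = atEndM feeds
layout-first (_ ∷ _) (_ ∷ _) feeds = atM feeds

layout-consecutive : ∀ {n} (as bs : Vec Bool n) c d x →
  Consecutive (layout as bs c d x) (layout as bs c d (suc x)) (layout as bs c d (2 + x))
layout-consecutive [] [] c d 0 = atEndC
layout-consecutive [] [] c d 1 = atEndW
layout-consecutive [] [] c d 2 = after
layout-consecutive [] [] c d (suc (suc (suc x))) = outside
layout-consecutive (a ∷ as) (b ∷ bs) c d 0 = atC
layout-consecutive (a ∷ as) (b ∷ bs) c d 1 = atW (layout-takes as bs _ _)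
layout-consecutive (a ∷ as) (b ∷ bs) c d 2 = layout-first as bs colW
layout-consecutive (a ∷ as) (b ∷ bs) c d (suc (suc (suc x))) = layout-consecutive as bs _ _ x

column-consecutive : ∀ {n} (as bs : Vec Bool n) z →
  Consecutive (column as bs (z ℤ.- ℤ.+ 1)) (column as bs z) (column as bs (z ℤ.+ ℤ.+ 1))
column-consecutive as bs -[1+ 0 ] = before
column-consecutive as bs -[1+ suc _ ] = outside
column-consecutive as bs (ℤ.+ 0) = atStart (layout-takes as bs false 0)
column-consecutive as bs (ℤ.+ 1) = layout-first as bs start
column-consecutive as bs (ℤ.+ suc (suc x)) rewrite ℕ.+-comm x 1 = layout-consecutive as bs false 0 x

layout-∅ : ∀ {n} (as bs : Vec Bool n) c d k → layout as bs c d (n * 3 + (3 + k)) ≡ ∅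
layout-∅ [] [] c d k = refl
layout-∅ (a ∷ as) (b ∷ bs) c d k = layout-∅ as bs _ _ k

frameAt : Col → ℤ → Maybe Tile
frameAt k (ℤ.+ y) = frame k y
frameAt k -[1+ _ ] = nothing

seedAt : Col → ℤ → Maybe Tile
seedAt k (ℤ.+ y) = frame k y <∣> Maybe.map bitT (input k y)
seedAt k -[1+ _ ] = nothing

seedAt-content : ∀ k y → seedAt k y ≡ (if isStatic k y then content k y else nothing)
seedAt-content k -[1+ _ ] = refl
seedAt-content k (ℤ.+ y) with frame k y | input k y
... | just _ | _ = refl
... | nothing | just _ = refl
... | nothing | nothing = refl

frame⇒content : ∀ k y {t} → frameAt k y ≡ just t → content k y ≡ just t
frame⇒content k (ℤ.+ y) eq rewrite eq = refl

isStatic⇒content : ∀ k y → isStatic k y ≡ true → ∃[ t ] content k y ≡ just t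
isStatic⇒content k (ℤ.+ y) eq with frame k y | input k y
... | just t | _ = t , refl
... | nothing | just v = bitT v , refl
isStatic⇒content k (ℤ.+ y) () | nothing | nothing

input⇒free : ∀ k y {v} → input k y ≡ just v → frame k y ≡ nothing
input⇒free (colC _ _ _ _) 2 eq = refl
input⇒free (colW _ _ _ _) 3 eq = refl

tabulateAsm : (Pos → Maybe Tile) → List Pos → Assembly
tabulateAsm h [] = []
tabulateAsm h (p ∷ ps) with h p
... | nothing = tabulateAsm h ps
... | just t  = (p , t) ∷ tabulateAsm h ps

∈-tabulateAsm⁺ : ∀ h ps {p t} → p ∈ ps → h p ≡ just t → (p , t) ∈ tabulateAsm h ps
∈-tabulateAsm⁺ h (p ∷ ps) (here refl) eq rewrite eq = here refl
∈-tabulateAsm⁺ h (q ∷ ps) (there p∈) eq with h q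
... | nothing = ∈-tabulateAsm⁺ h ps p∈ eq
... | just _  = there (∈-tabulateAsm⁺ h ps p∈ eq)

∈-tabulateAsm⁻ : ∀ h ps {p t} → (p , t) ∈ tabulateAsm h ps → p ∈ ps × h p ≡ just t
∈-tabulateAsm⁻ h (q ∷ ps) p∈ with h q in eq
∈-tabulateAsm⁻ h (q ∷ ps) p∈ | nothing with q∈ , eq′ ← ∈-tabulateAsm⁻ h ps p∈ = there q∈ , eq′
∈-tabulateAsm⁻ h (q ∷ ps) (here refl) | just _ = here refl , eq
∈-tabulateAsm⁻ h (q ∷ ps) (there p∈)  | just _ with q∈ , eq′ ← ∈-tabulateAsm⁻ h ps p∈ = there q∈ , eq′

WF-tabulateAsm : ∀ h {ps} → Unique ps → WF (tabulateAsm h ps)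
WF-tabulateAsm h {[]} [] = []
WF-tabulateAsm h {q ∷ ps} (q∉ ∷ u) with h q
... | nothing = WF-tabulateAsm h u
... | just _ = All.tabulate fresh-head ∷ WF-tabulateAsm h u
  where
  fresh-head : ∀ {p} → p ∈ map proj₁ (tabulateAsm h ps) → q ≢ p
  fresh-head p∈ with e , e∈ , refl ← ∈-map⁻ proj₁ p∈ = All.lookup q∉ (proj₁ (∈-tabulateAsm⁻ h ps e∈))

at-tabulateAsm : ∀ h {ps} → Unique ps → (∀ {p t} → h p ≡ just t → p ∈ ps) → ∀ p → at (tabulateAsm h ps) p ≡ h p
at-tabulateAsm h {ps} u cover = at≡graph (WF-tabulateAsm h u)
  (λ e∈ → proj₂ (∈-tabulateAsm⁻ h ps e∈)) (λ eq → ∈-tabulateAsm⁺ h ps (cover eq) eq)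

grid : ℕ → List Pos
grid n = cartesianProductWith (λ x y → (ℤ.+ x , ℤ.+ y)) (upTo (4 + n * 3)) (upTo 8)

grid-unique : ∀ n → Unique (grid n)
grid-unique n = cartesianProductWith⁺ _ (λ { refl → refl , refl }) (upTo⁺ (4 + n * 3)) (upTo⁺ 8)

contentOf : ∀ {n} → Vec Bool n → Vec Bool n → Pos → Maybe Tile
contentOf as bs (x , y) = content (column as bs x) y

frameOf : ∀ {n} → Vec Bool n → Vec Bool n → Pos → Maybe Tile
frameOf as bs (x , y) = frameAt (column as bs x) y

seedOf : ∀ {n} → Vec Bool n → Vec Bool n → Pos → Maybe Tile
seedOf as bs (x , y) = seedAt (column as bs x) y

column-∅ : ∀ {n} (as bs : Vec Bool n) k → columnℕ as bs (4 + n * 3 + k) ≡ ∅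
column-∅ {n} as bs k =
  trans (cong (layout as bs false 0) (trans (cong (_+ k) (ℕ.+-comm 3 (n * 3))) (ℕ.+-assoc (n * 3) 3 k)))
    (layout-∅ as bs false 0 k)

content-grid : ∀ {n} (as bs : Vec Bool n) {p t} → contentOf as bs p ≡ just t → p ∈ grid n
content-grid {n} as bs {ℤ.+ x , ℤ.+ y} eq with x ℕ.<? 4 + n * 3 | y ℕ.<? 8
... | yes x< | yes y< = ∈-cartesianProductWith⁺ (λ x y → (ℤ.+ x , ℤ.+ y)) (∈-upTo⁺ x<) (∈-upTo⁺ y<)
... | _ | no y≮ with k , refl ← ℕ.m≤n⇒∃[o]m+o≡n (ℕ.≮⇒≥ y≮)
                with () ← trans (sym (content-top (columnℕ as bs x) k)) eq
... | no x≮ | _ with k , refl ← ℕ.m≤n⇒∃[o]m+o≡n (ℕ.≮⇒≥ x≮)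
                with () ← trans (sym (cong (λ c → content c (ℤ.+ y)) (column-∅ as bs k))) eq

layout-skeleton : ∀ {n} (as bs as′ bs′ : Vec Bool n) {c c′ d d′} x →
  skeleton (layout as bs c d x) ≡ skeleton (layout as′ bs′ c′ d′ x)
layout-skeleton [] [] [] [] 0 = refl
layout-skeleton [] [] [] [] 1 = refl
layout-skeleton [] [] [] [] 2 = refl
layout-skeleton [] [] [] [] (suc (suc (suc x))) = refl
layout-skeleton (_ ∷ _) (_ ∷ _) (_ ∷ _) (_ ∷ _) 0 = refl
layout-skeleton (_ ∷ _) (_ ∷ _) (_ ∷ _) (_ ∷ _) 1 = refl
layout-skeleton (_ ∷ _) (_ ∷ _) (_ ∷ _) (_ ∷ _) 2 = refl
layout-skeleton (_ ∷ as) (_ ∷ bs) (_ ∷ as′) (_ ∷ bs′) (suc (suc (suc x))) = layout-skeleton as bs as′ bs′ x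

frameOf-const : ∀ {n} (as bs as′ bs′ : Vec Bool n) p → frameOf as bs p ≡ frameOf as′ bs′ p
frameOf-const as bs as′ bs′ (ℤ.+ 0 , ℤ.+ y) = refl
frameOf-const as bs as′ bs′ (ℤ.+ suc x , ℤ.+ y) = cong (λ k → skeletonFrame k y) (layout-skeleton as bs as′ bs′ x)
frameOf-const as bs as′ bs′ (ℤ.+ x , -[1+ _ ]) = refl
frameOf-const as bs as′ bs′ (-[1+ _ ] , ℤ.+ y) = refl
frameOf-const as bs as′ bs′ (-[1+ _ ] , -[1+ _ ]) = refl

layout-a : ∀ {n} (as bs : Vec Bool n) c d i → input (layout as bs c d (toℕ i * 3 + 1)) 2 ≡ just (lookup as i)
layout-a (a ∷ as) (b ∷ bs) c d zero = refl
layout-a (a ∷ as) (b ∷ bs) c d (suc i) = layout-a as bs _ _ i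

layout-b : ∀ {n} (as bs : Vec Bool n) c d i → input (layout as bs c d (toℕ i * 3 + 2)) 3 ≡ just (lookup bs i)
layout-b (a ∷ as) (b ∷ bs) c d zero = refl
layout-b (a ∷ as) (b ∷ bs) c d (suc i) = layout-b as bs _ _ i

layout-input : ∀ {n} (as bs : Vec Bool n) c d x y {v} → input (layout as bs c d x) y ≡ just v →
  (∃[ i ] x ≡ toℕ i * 3 + 1 × y ≡ 2 × v ≡ lookup as i) ⊎ (∃[ i ] x ≡ toℕ i * 3 + 2 × y ≡ 3 × v ≡ lookup bs i)
layout-input (a ∷ as) (b ∷ bs) c d 1 2 refl = inj₁ (zero , refl , refl , refl)
layout-input (a ∷ as) (b ∷ bs) c d 2 3 refl = inj₂ (zero , refl , refl , refl)
layout-input (a ∷ as) (b ∷ bs) c d (suc (suc (suc x))) y eq with layout-input as bs _ _ x y eq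
... | inj₁ (i , p , q) = inj₁ (suc i , cong (3 +_) p , q)
... | inj₂ (i , p , q) = inj₂ (suc i , cong (3 +_) p , q)
layout-input [] [] c d 0 y ()
layout-input [] [] c d 1 y ()
layout-input [] [] c d 2 y ()
layout-input [] [] c d (suc (suc (suc _))) y ()

-- Column o of the block of bit i, with `suc` for the start column. The pairs (o , y) in use are (1
-- , 2) for a, (2 , 3) for b and (1 , 6) for the output.
cell : ℕ → ℕ → ∀ {n} → Fin n → Pos
cell o y i = ℤ.+ suc (toℕ i * 3 + o) , ℤ.+ y

cell-injective : ∀ o y {n} {i j : Fin n} → cell o y i ≡ cell o y j → i ≡ j
cell-injective o y {i = i} {j} eq = toℕ-injective (ℕ.*-cancelʳ-≡ (toℕ i) (toℕ j) 3
  (ℕ.+-cancelʳ-≡ o (toℕ i * 3) (toℕ j * 3) (ℕ.suc-injective (ℤ.+-injective (cong proj₁ eq)))))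

positions : ∀ n → ℕ → ℕ → Vec Pos n
positions n o y = Vec.tabulate (cell o y)

toList-tabulate : ∀ {n} {A : Set} (f : Fin n → A) → toList (Vec.tabulate f) ≡ List.tabulate f
toList-tabulate {zero} f = refl
toList-tabulate {suc n} f = cong (f zero ∷_) (toList-tabulate (f ∘ suc))

inputs : ∀ n → Vec Pos (n + n)
inputs n = positions n 1 2 Vec.++ positions n 2 3

inputs-unique : ∀ n → Unique (toList (inputs n))
inputs-unique n = subst Unique (sym list≡) (++⁺ (tabulate⁺ (cell-injective 1 2)) (tabulate⁺ (cell-injective 2 3)) disjoint)
  where
  list≡ : toList (inputs n) ≡ List.tabulate (cell 1 2 {n}) List.++ List.tabulate (cell 2 3 {n})
  list≡ = trans (toList-++ (positions n 1 2) (positions n 2 3)) (cong₂ List._++_ (toList-tabulate (cell 1 2 {n})) (toList-tabulate (cell 2 3 {n})))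
  disjoint : ∀ {p} → p ∈ List.tabulate (cell 1 2 {n}) × p ∈ List.tabulate (cell 2 3 {n}) → _
  disjoint (p∈ , p∈′) with i , refl ← ∈-tabulate⁻ p∈ with j , () ← ∈-tabulate⁻ p∈′

inputs-seed : ∀ {n} (as bs : Vec Bool n) j → let (x , y) = lookup (inputs n) j in
  ∃[ y′ ] y ≡ ℤ.+ y′ × input (column as bs x) y′ ≡ just (lookup (as Vec.++ bs) j)
inputs-seed {n} as bs j
  rewrite lookup-splitAt n (positions n 1 2) (positions n 2 3) j | lookup-splitAt n as bs j with splitAt n j
... | inj₁ i rewrite lookup∘tabulate (cell 1 2) i = 2 , refl , layout-a as bs false 0 i
... | inj₂ i rewrite lookup∘tabulate (cell 2 3) i = 3 , refl , layout-b as bs false 0 i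

seed-inputs : ∀ {n} (as bs : Vec Bool n) x y {v} → input (columnℕ as bs x) y ≡ just v →
  ∃[ j ] lookup (inputs n) j ≡ (ℤ.+ x , ℤ.+ y) × lookup (as Vec.++ bs) j ≡ v
seed-inputs {n} as bs (suc x) y eq with layout-input as bs false 0 x y eq
... | inj₁ (i , refl , refl , refl) = i ↑ˡ n
    , trans (lookup-++ˡ (positions n 1 2) (positions n 2 3) i) (lookup∘tabulate (cell 1 2) i) , lookup-++ˡ as bs i
... | inj₂ (i , refl , refl , refl) = n ↑ʳ i
    , trans (lookup-++ʳ (positions n 1 2) (positions n 2 3) i) (lookup∘tabulate (cell 2 3) i) , lookup-++ʳ as bs i

-- The template and the tile assembly computer

zeros : ∀ n → Vec Bool n
zeros n = replicate n false

-- `R` is fixed before the input is known, so it is read off the layout of the zero input; by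
-- `frameOf-const` every input yields the same frame.
template : ℕ → Assembly
template n = tabulateAsm (frameOf (zeros n) (zeros n)) (grid n)

at-template : ∀ {n} (as bs : Vec Bool n) p → at (template n) p ≡ frameOf as bs p
at-template {n} as bs p = trans
  (at-tabulateAsm (frameOf (zeros n) (zeros n)) (grid-unique n)
    (λ {p} eq → content-grid (zeros n) (zeros n) (frame⇒content (column (zeros n) (zeros n) (proj₁ p)) (proj₂ p) eq)) p)
  (frameOf-const (zeros n) (zeros n) as bs p)

bitT-unique : ∀ b t → t ∈ tileSet → label t ≡ bit b → t ≡ bitT b
bitT-unique b t t∈ eq = eqTile-sound t (bitT b) (∨-elim (eq⇒ eq) (all-sound (P b) tileSet (ok b) t∈))
  where
  P : Bool → Tile → Bool
  P b t = not (label t ≡ᵇ bit b) ∨ eqTile t (bitT b)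
  ok : ∀ b → all (P b) tileSet ≡ true
  ok true = refl
  ok false = refl
  eq⇒ : label t ≡ bit b → (label t ≡ᵇ bit b) ≡ true
  eq⇒ refl = ≡ᵇ-refl (label t)
  ∨-elim : ∀ {x y} → x ≡ true → not x ∨ y ≡ true → y ≡ true
  ∨-elim refl eq = eq

template-over : ∀ n → All (λ e → proj₂ e ∈ tileSet × proj₂ e ≢ bitT false × proj₂ e ≢ bitT true) (template n)
template-over n = All.tabulate over
  where
  over : ∀ {e} → e ∈ template n → proj₂ e ∈ tileSet × proj₂ e ≢ bitT false × proj₂ e ≢ bitT true
  over {(ℤ.+ x , ℤ.+ y) , t} e∈ with _ , eq ← ∈-tabulateAsm⁻ (frameOf (zeros n) (zeros n)) (grid n) e∈
    with t∈ , l ← frame∈ (columnℕ (zeros n) (zeros n) x) y eq = t∈ , (λ { refl → contradiction l λ () }) , (λ { refl → contradiction l λ () })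
  over {(ℤ.+ x , -[1+ y ]) , t} e∈ with _ , () ← ∈-tabulateAsm⁻ (frameOf (zeros n) (zeros n)) (grid n) e∈
  over {(-[1+ x ] , ℤ.+ y) , t} e∈ with _ , () ← ∈-tabulateAsm⁻ (frameOf (zeros n) (zeros n)) (grid n) e∈
  over {(-[1+ x ] , -[1+ y ]) , t} e∈ with _ , () ← ∈-tabulateAsm⁻ (frameOf (zeros n) (zeros n)) (grid n) e∈

template-free : ∀ n j → at (template n) (lookup (inputs n) j) ≡ nothing
template-free n j with y , y≡ , eq ← inputs-seed (zeros n) (zeros n) j =
  trans (at-template (zeros n) (zeros n) (lookup (inputs n) j))
    (trans (cong (frameAt (column (zeros n) (zeros n) (proj₁ (lookup (inputs n) j)))) y≡)
      (input⇒free (column (zeros n) (zeros n) (proj₁ (lookup (inputs n) j))) y eq))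

adder : ∀ n → TAC (n + n) (suc n)
adder n = record
  { tiles = tileSet
  ; t0 = bitT false
  ; t1 = bitT true
  ; t0∈ = here refl
  ; t1∈ = there (here refl)
  ; t0-label = refl
  ; t1-label = refl
  ; t0-unique = bitT-unique false
  ; t1-unique = bitT-unique true
  ; R = template n
  ; R-wf = WF-tabulateAsm (frameOf (zeros n) (zeros n)) (grid-unique n)
  ; R-over = template-over n
  ; B = inputs n
  ; B-distinct = inputs-unique n
  ; B-free = template-free n
  ; C = positions (suc n) 1 6
  ; τ = 2
  }

-- Stability of the seed

-- What `strong-edge` says about a light cut, detached from the assembly so that `Linked-shift` can
-- pass it on to the remaining bits.
record Linked (col : ℕ → Col) (X : ℕ → ℕ → Bool) : Set where
  field
    up    : ∀ x y {s t} → seedAt (col x) (ℤ.+ y) ≡ just s → seedAt (col x) (ℤ.+ suc y) ≡ just t →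
            2 ≤ bond N s t → X x y ≡ X x (suc y)
    right : ∀ x y {s t} → seedAt (col x) (ℤ.+ y) ≡ just s → seedAt (col (suc x)) (ℤ.+ y) ≡ just t →
            2 ≤ bond E s t → X x y ≡ X (suc x) y

Linked-shift : ∀ k {col X} → Linked col X → Linked (col ∘ (k +_)) (X ∘ (k +_))
Linked-shift k {col} {X} linked = record
  { up = λ x → up (k + x)
  ; right = λ x y {t = t} p q le → subst (λ x′ → X (k + x) y ≡ X x′ y) (sym (ℕ.+-suc k x))
      (right (k + x) y p (subst (λ x′ → seedAt (col x′) (ℤ.+ y) ≡ just t) (ℕ.+-suc k x) q) le) }
  where open Linked linked

layout-bottom : ∀ {n} (as bs : Vec Bool n) c d → ∃[ t ] seedAt (layout as bs c d 0) (ℤ.+ 1) ≡ just t × west t ≡ chain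
layout-bottom [] [] c d = foot , refl , refl
layout-bottom (_ ∷ _) (_ ∷ _) c d = ground , refl , refl

layout-top : ∀ {n} (as bs : Vec Bool n) c d → ∃[ t ] seedAt (layout as bs c d 0) (ℤ.+ 7) ≡ just t × west t ≡ chain
layout-top [] [] c d = rail , refl , refl
layout-top (_ ∷ _) (_ ∷ _) c d = rail , refl , refl

chained : ∀ s t → east s ≡ chain → west t ≡ chain → 2 ≤ bond E s t
chained s t p q rewrite p | q = ≤-refl

-- Row 4 stays free for the carry, so within a bit nothing static joins the bottom chain to the top
-- chain. They meet only in the closing column `endW`; row 7 is therefore reached from the right,
-- through the tail.
layout-connected : ∀ {n} (as bs : Vec Bool n) c d X → Linked (layout as bs c d) X →
  ∀ x y {t} → seedAt (layout as bs c d x) (ℤ.+ y) ≡ just t → X x y ≡ X 0 1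
layout-connected [] [] c d X linked = go
  where
  open Linked linked
  r₁ : X 1 1 ≡ X 0 1
  r₁ = sym (right 0 1 refl refl ≤-refl)
  v₁ : X 2 1 ≡ X 0 1
  v₁ = trans (sym (right 1 1 refl refl ≤-refl)) r₁
  v₂ : X 2 2 ≡ X 0 1
  v₂ = trans (sym (up 2 1 refl refl ≤-refl)) v₁
  v₃ : X 2 3 ≡ X 0 1
  v₃ = trans (sym (up 2 2 refl refl ≤-refl)) v₂
  v₄ : X 2 4 ≡ X 0 1
  v₄ = trans (sym (up 2 3 refl refl ≤-refl)) v₃
  v₅ : X 2 5 ≡ X 0 1
  v₅ = trans (sym (up 2 4 refl refl ≤-refl)) v₄
  v₆ : X 2 6 ≡ X 0 1
  v₆ = trans (sym (up 2 5 refl refl ≤-refl)) v₅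
  v₇ : X 2 7 ≡ X 0 1
  v₇ = trans (sym (up 2 6 refl refl ≤-refl)) v₆
  go : ∀ x y {t} → seedAt (layout [] [] c d x) (ℤ.+ y) ≡ just t → X x y ≡ X 0 1
  go 0 1 _ = refl
  go 0 2 _ = sym (up 0 1 refl refl ≤-refl)
  go 0 3 _ = sym (trans (up 0 1 refl refl ≤-refl) (up 0 2 refl refl ≤-refl))
  go 0 7 _ = trans (right 0 7 refl refl ≤-refl) (trans (right 1 7 refl refl ≤-refl) v₇)
  go 1 1 _ = r₁
  go 1 5 _ = trans (right 1 5 refl refl ≤-refl) v₅
  go 1 7 _ = trans (right 1 7 refl refl ≤-refl) v₇
  go 2 1 _ = v₁
  go 2 2 _ = v₂
  go 2 3 _ = v₃
  go 2 4 _ = v₄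
  go 2 5 _ = v₅
  go 2 6 _ = v₆
  go 2 7 _ = v₇
layout-connected (a ∷ as) (b ∷ bs) c d X linked = go
  where
  open Linked linked
  c′ = majority a b c
  d′ = delay a b d
  tail : ∀ x y {t} → seedAt (layout as bs c′ d′ x) (ℤ.+ y) ≡ just t → X (3 + x) y ≡ X 3 1
  tail = layout-connected as bs c′ d′ (X ∘ (3 +_)) (Linked-shift 3 linked)
  r₁ : X 1 1 ≡ X 0 1
  r₁ = sym (right 0 1 refl refl ≤-refl)
  r₂ : X 2 1 ≡ X 0 1
  r₂ = trans (sym (right 1 1 refl refl ≤-refl)) r₁
  r₃ : X 3 1 ≡ X 0 1
  r₃ with t , eq , w ← layout-bottom as bs c′ d′ = trans (sym (right 2 1 refl eq (chained foot t refl w))) r₂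
  w₇ : X 2 7 ≡ X 0 1
  w₇ with t , eq , w ← layout-top as bs c′ d′ =
    trans (right 2 7 refl eq (chained corner t refl w)) (trans (tail 0 7 eq) r₃)
  w₅ : X 2 5 ≡ X 0 1
  w₅ = trans (up 2 5 refl refl ≤-refl) (trans (up 2 6 refl refl ≤-refl) w₇)
  go : ∀ x y {t} → seedAt (layout (a ∷ as) (b ∷ bs) c d x) (ℤ.+ y) ≡ just t → X x y ≡ X 0 1
  go 0 1 _ = refl
  go 0 7 _ = trans (right 0 7 refl refl ≤-refl) (trans (right 1 7 refl refl ≤-refl) w₇)
  go 1 1 _ = r₁
  go 1 2 _ = trans (sym (up 1 1 refl refl ≤-refl)) r₁
  go 1 5 _ = trans (right 1 5 refl refl ≤-refl) w₅
  go 1 7 _ = trans (right 1 7 refl refl ≤-refl) w₇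
  go 2 1 _ = r₂
  go 2 2 _ = trans (sym (up 2 1 refl refl ≤-refl)) r₂
  go 2 3 _ = trans (sym (up 2 2 refl refl ≤-refl)) (trans (sym (up 2 1 refl refl ≤-refl)) r₂)
  go 2 5 _ = w₅
  go 2 6 _ = trans (up 2 6 refl refl ≤-refl) w₇
  go 2 7 _ = w₇
  go (suc (suc (suc x))) y eq = trans (tail x y eq) r₃

column-connected : ∀ {n} (as bs : Vec Bool n) X → Linked (columnℕ as bs) X →
  ∀ x y {t} → seedAt (columnℕ as bs x) (ℤ.+ y) ≡ just t → X x y ≡ X 1 1
column-connected as bs X linked = go
  where
  open Linked linked
  tail : ∀ x y {t} → seedAt (layout as bs false 0 x) (ℤ.+ y) ≡ just t → X (suc x) y ≡ X 1 1
  tail = layout-connected as bs false 0 (X ∘ suc) (Linked-shift 1 linked)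
  s₁ : X 0 1 ≡ X 1 1
  s₁ with t , eq , w ← layout-bottom as bs false 0 = right 0 1 refl eq (chained start₁ t refl w)
  s₂ : X 0 2 ≡ X 1 1
  s₂ = trans (sym (up 0 1 refl refl ≤-refl)) s₁
  s₃ : X 0 3 ≡ X 1 1
  s₃ = trans (sym (up 0 2 refl refl ≤-refl)) s₂
  go : ∀ x y {t} → seedAt (columnℕ as bs x) (ℤ.+ y) ≡ just t → X x y ≡ X 1 1
  go 0 1 _ = s₁
  go 0 2 _ = s₂
  go 0 3 _ = s₃
  go 0 4 _ = trans (sym (up 0 3 refl refl ≤-refl)) s₃
  go 0 7 _ with t , eq , w ← layout-top as bs false 0 = trans (right 0 7 refl eq (chained ledge t refl w)) (tail 0 7 eq)
  go (suc x) y eq = tail x y eq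

bitTile≡bitT : ∀ b → bitTile (bitT false) (bitT true) b ≡ bitT b
bitTile≡bitT true = refl
bitTile≡bitT false = refl

placeBit : Pos → Bool → Pos × Tile
placeBit p b = p , bitTile (bitT false) (bitT true) b

frame⇒seed : ∀ k y {t} → frameAt k y ≡ just t → seedAt k y ≡ just t
frame⇒seed k (ℤ.+ y) eq rewrite eq = refl

toList-index : ∀ {A : Set} {n x} (xs : Vec A n) → x ∈ toList xs → ∃[ i ] lookup xs i ≡ x
toList-index (x ∷ xs) (here eq) = zero , sym eq
toList-index (x ∷ xs) (there x∈) with i , eq ← toList-index xs x∈ = suc i , eq

module Inputs {n} (as bs : Vec Bool n) where

  Sd : Assembly
  Sd = inputAsm (adder n) (as Vec.++ bs)

  placed : Assembly
  placed = toList (zipWith placeBit (inputs n) (as Vec.++ bs))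

  placed-seed : ∀ {p t} → (p , t) ∈ placed → seedOf as bs p ≡ just t
  placed-seed e∈ with j , refl ← toList-index (zipWith placeBit (inputs n) (as Vec.++ bs)) e∈
    rewrite lookup-zipWith placeBit j (inputs n) (as Vec.++ bs)
    with y , y≡ , inp ← inputs-seed as bs j =
      trans (cong (seedAt k) y≡) (trans seed≡ (cong just (sym (bitTile≡bitT _))))
    where
    k = column as bs (proj₁ (lookup (inputs n) j))
    seed≡ : seedAt k (ℤ.+ y) ≡ just (bitT (lookup (as Vec.++ bs) j))
    seed≡ rewrite input⇒free k y inp | inp = refl

  seed⇒Sd : ∀ {p t} → seedOf as bs p ≡ just t → (p , t) ∈ Sd
  seed⇒Sd {ℤ.+ x , ℤ.+ y} eq with frame (columnℕ as bs x) y in eqf | input (columnℕ as bs x) y in eqi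
  seed⇒Sd {ℤ.+ x , ℤ.+ y} refl | just t | _ = ∈-++⁺ˡ (at⇒∈ (template n) (trans (at-template as bs (ℤ.+ x , ℤ.+ y)) eqf))
  seed⇒Sd {ℤ.+ x , ℤ.+ y} refl | nothing | just v with j , pos , bit≡ ← seed-inputs as bs x y eqi =
    ∈-++⁺ʳ (template n) (subst (_∈ placed) (trans (lookup-zipWith placeBit j (inputs n) (as Vec.++ bs))
      (cong₂ _,_ pos (trans (bitTile≡bitT _) (cong bitT bit≡)))) (Vec∈.∈-toList⁺ (Vec∈.∈-lookup j _)))

  Sd-wf : WF Sd
  Sd-wf = subst Unique (sym (trans (map-++ proj₁ (template n) placed) (cong (map proj₁ (template n) List.++_) (proj₁-placed (inputs n) (as Vec.++ bs)))))
    (++⁺ (WF-tabulateAsm (frameOf (zeros n) (zeros n)) (grid-unique n)) (inputs-unique n) disjoint)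
    where
    proj₁-placed : ∀ {m} (ps : Vec Pos m) xs → map proj₁ (toList (zipWith placeBit ps xs)) ≡ toList ps
    proj₁-placed [] [] = refl
    proj₁-placed (p ∷ ps) (x ∷ xs) = cong (p ∷_) (proj₁-placed ps xs)
    disjoint : ∀ {p} → p ∈ map proj₁ (template n) × p ∈ toList (inputs n) → _
    disjoint (p∈ , p∈′) with (p , t) , e∈ , refl ← ∈-map⁻ proj₁ p∈ with j , eq ← toList-index (inputs n) p∈′ =
      contradiction eq (at≡nothing⇒≢ (template-free n j) e∈)

  Sd-seed : ∀ p → at Sd p ≡ seedOf as bs p
  Sd-seed = at≡graph Sd-wf only seed⇒Sd
    where
    only : ∀ {p t} → (p , t) ∈ Sd → seedOf as bs p ≡ just t
    only {p} {t} e∈ with ∈-++⁻ (template n) e∈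
    ... | inj₂ e∈placed = placed-seed e∈placed
    ... | inj₁ e∈R = frame⇒seed (column as bs (proj₁ p)) (proj₂ p)
      (trans (frameOf-const as bs (zeros n) (zeros n) p) (proj₂ (∈-tabulateAsm⁻ (frameOf (zeros n) (zeros n)) (grid n) e∈R)))

  Sd-linked : ∀ X → cutWeight Sd X < 2 → Linked (columnℕ as bs) (λ x y → X (ℤ.+ x , ℤ.+ y))
  Sd-linked X small = record { up = up ; right = right }
    where
    at-Sd : ∀ x y {t} → seedAt (columnℕ as bs x) (ℤ.+ y) ≡ just t → at Sd (ℤ.+ x , ℤ.+ y) ≡ just t
    at-Sd x y = trans (Sd-seed (ℤ.+ x , ℤ.+ y))
    up : ∀ x y {s t} → seedAt (columnℕ as bs x) (ℤ.+ y) ≡ just s → seedAt (columnℕ as bs x) (ℤ.+ suc y) ≡ just t →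
      2 ≤ bond N s t → X (ℤ.+ x , ℤ.+ y) ≡ X (ℤ.+ x , ℤ.+ suc y)
    up x y p q le = trans
      (strong-edge N X small Sd-wf (at-Sd x y p) (trans (cong (at Sd) above) (at-Sd x (suc y) q)) le) (cong X above)
      where
      above : neighbour N (ℤ.+ x , ℤ.+ y) ≡ (ℤ.+ x , ℤ.+ suc y)
      above = cong (λ y → ℤ.+ x , ℤ.+ y) (ℕ.+-comm y 1)
    right : ∀ x y {s t} → seedAt (columnℕ as bs x) (ℤ.+ y) ≡ just s → seedAt (columnℕ as bs (suc x)) (ℤ.+ y) ≡ just t →
      2 ≤ bond E s t → X (ℤ.+ x , ℤ.+ y) ≡ X (ℤ.+ suc x , ℤ.+ y)
    right x y p q le = trans
      (strong-edge E X small Sd-wf (at-Sd x y p) (trans (cong (at Sd) beside) (at-Sd (suc x) y q)) le) (cong X beside)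
      where
      beside : neighbour E (ℤ.+ x , ℤ.+ y) ≡ (ℤ.+ suc x , ℤ.+ y)
      beside = cong (λ x → ℤ.+ x , ℤ.+ y) (ℕ.+-comm x 1)

  Sd-stable : Stable 2 Sd
  Sd-stable = connected⇒Stable (λ X small → X (ℤ.+ 1 , ℤ.+ 1) , λ {p} eq → const X small p (trans (sym (Sd-seed p)) eq)) Sd-wf
    where
    const : ∀ X → cutWeight Sd X < 2 → ∀ p {t} → seedOf as bs p ≡ just t → X p ≡ X (ℤ.+ 1 , ℤ.+ 1)
    const X small (ℤ.+ x , ℤ.+ y) = column-connected as bs (λ x y → X (ℤ.+ x , ℤ.+ y)) (Sd-linked X small) x y
    const X small (-[1+ _ ] , -[1+ _ ]) ()

-- The adder assembly

-- The empty case contributes d, because the closing block also waits for a run that reaches the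
-- last bit.
longest : ∀ {n} → Vec Bool n → Vec Bool n → ℕ → ℕ
longest [] [] d = d
longest (a ∷ as) (b ∷ bs) d = d ⊔ longest as bs (delay a b d)

layout-waiting : ∀ {n} (as bs : Vec Bool n) c d x → waiting (layout as bs c d x) ≤ longest as bs d
layout-waiting [] [] c d 0 = ≤-refl
layout-waiting [] [] c d 1 = ≤-refl
layout-waiting [] [] c d 2 = z≤n
layout-waiting [] [] c d (suc (suc (suc x))) = z≤n
layout-waiting (a ∷ as) (b ∷ bs) c d 0 = ℕ.m≤m⊔n _ _
layout-waiting (a ∷ as) (b ∷ bs) c d 1 = ℕ.m≤m⊔n _ _
layout-waiting (a ∷ as) (b ∷ bs) c d 2 = ℕ.m≤m⊔n _ _
layout-waiting (a ∷ as) (b ∷ bs) c d (suc (suc (suc x))) = ≤-trans (layout-waiting as bs _ _ x) (ℕ.m≤n⊔m d _)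

column-waiting : ∀ {n} (as bs : Vec Bool n) z → waiting (column as bs z) ≤ longest as bs 0
column-waiting as bs (ℤ.+ 0) = z≤n
column-waiting as bs (ℤ.+ suc x) = layout-waiting as bs false 0 x
column-waiting as bs -[1+ _ ] = z≤n

total : ∀ {n} → Vec Bool n → Vec Bool n → Bool → Vec Bool (suc n)
total [] [] c = c ∷ []
total (a ∷ as) (b ∷ bs) c = ((a xor b) xor c) ∷ total as bs (majority a b c)

total-val : ∀ {n} (as bs : Vec Bool n) c → val (total as bs c) ≡ bit c + (val as + val bs)
total-val [] [] c = refl
total-val (a ∷ as) (b ∷ bs) c = trans (cong (λ v → bit ((a xor b) xor c) + 2 * v) (total-val as bs (majority a b c)))
  (begin
    bit ((a xor b) xor c) + 2 * (bit (majority a b c) + (val as + val bs))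
      ≡⟨ solve 4 (λ s m x y → s :+ con 2 :* (m :+ (x :+ y)) := (s :+ con 2 :* m) :+ (con 2 :* x :+ con 2 :* y)) refl
           (bit ((a xor b) xor c)) (bit (majority a b c)) (val as) (val bs) ⟩
    (bit ((a xor b) xor c) + 2 * bit (majority a b c)) + (2 * val as + 2 * val bs)
      ≡⟨ cong (_+ (2 * val as + 2 * val bs)) (full-adder a b c) ⟩
    (bit c + (bit a + bit b)) + (2 * val as + 2 * val bs)
      ≡⟨ solve 5 (λ c a b x y → (c :+ (a :+ b)) :+ (x :+ y) := c :+ ((a :+ x) :+ (b :+ y))) refl
           (bit c) (bit a) (bit b) (2 * val as) (2 * val bs) ⟩
    bit c + ((bit a + 2 * val as) + (bit b + 2 * val bs)) ∎)
  where
  open ≡-Reasoning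
  full-adder : ∀ a b c → bit ((a xor b) xor c) + 2 * bit (majority a b c) ≡ bit c + (bit a + bit b)
  full-adder true true true = refl
  full-adder true true false = refl
  full-adder true false true = refl
  full-adder true false false = refl
  full-adder false true true = refl
  full-adder false true false = refl
  full-adder false false true = refl
  full-adder false false false = refl

layout-output : ∀ {n} (as bs : Vec Bool n) c d (i : Fin (suc n)) →
  content (layout as bs c d (toℕ i * 3 + 1)) (ℤ.+ 6) ≡ just (bitT (lookup (total as bs c) i))
layout-output [] [] c d zero = refl
layout-output (a ∷ as) (b ∷ bs) c d zero = refl
layout-output (a ∷ as) (b ∷ bs) c d (suc i) = layout-output as bs _ _ i

module Result {n} (as bs : Vec Bool n) where
  open Inputs as bs

  F : Assembly
  F = tabulateAsm (contentOf as bs) (grid n)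

  at-F : ∀ p → at F p ≡ contentOf as bs p
  at-F = at-tabulateAsm (contentOf as bs) (grid-unique n) (content-grid as bs)

  isSeed : Pos → Bool
  isSeed (x , y) = isStatic (column as bs x) y

  timeOf : Pos → ℕ
  timeOf (x , y) = time (column as bs x) y

  grownAt : ∀ p {t} → at F p ≡ just t → isSeed p ≡ false → Grown (column as bs (proj₁ p)) (proj₂ p) t
  grownAt (x , y) eq = content-view (column as bs x) y (trans (sym (at-F (x , y))) eq)

  target : IsTarget tileSet 2 Sd F isSeed timeOf (7 + longest as bs 0 * 3)
  target = record
    { F-wf = WF-tabulateAsm (contentOf as bs) (grid-unique n)
    ; Sd-wf = Sd-wf
    ; Sd-stable = Sd-stable
    ; Sd-nonempty = ((ℤ.+ 0 , ℤ.+ 1) , start₁) , at⇒∈ Sd (Sd-seed (ℤ.+ 0 , ℤ.+ 1))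
    ; Sd-at = λ p → trans (Sd-seed p) (trans (seedAt-content (column as bs (proj₁ p)) (proj₂ p))
        (cong (if isSeed p then_else nothing) (sym (at-F p))))
    ; seed⇒F = λ {p} s → let t , eq = isStatic⇒content (column as bs (proj₁ p)) (proj₂ p) s in t , trans (at-F p) eq
    ; sound = λ {p} {t} t∈ ns le → trans (at-F p)
        (check-sound (column-consecutive as bs (proj₁ p)) (proj₂ p) t∈ ns
          (subst (2 ≤_) (attraction-cong {at F} {contentOf as bs} at-F p t) le))
    ; F-tiles = λ {p} eq ns → grown∈ (grownAt p eq ns)
    ; progress = λ {p} {t} eq ns g agree →
        let see = λ q h → trans (agree q h) (at-F q)
        in local-progress (column-consecutive as bs (proj₁ p)) (grownAt p eq ns) _ _ _ _
          (see (neighbour N p)) (see (neighbour E p)) (see (neighbour S p)) (see (neighbour W p))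
    ; time≤D = λ {p} eq ns → ≤-trans (time≤ (grownAt p eq ns))
        (ℕ.+-monoʳ-≤ 7 (ℕ.*-monoˡ-≤ 3 (column-waiting as bs (proj₁ p))))
    }

  open Growth target using (assembles; runTime) public

  represents : Represents (C (adder n)) F (total as bs false)
  represents i = bitT (lookup (total as bs false) i)
    , trans (cong (at F) (lookup∘tabulate (cell 1 6) i))
        (trans (at-F (cell 1 6 i)) (layout-output as bs false 0 i))
    , label≡ (lookup (total as bs false) i)
    where
    label≡ : ∀ b → bit b ≡ bitLabel b
    label≡ true = refl
    label≡ false = refl

-- The average carry chain

Σᵛ : ∀ m → (Vec Bool m → ℕ) → ℕ
Σᵛ m g = sum (map g (allVecs m))

Σᵛ-suc : ∀ m g → Σᵛ (suc m) g ≡ Σᵛ m (g ∘ (true ∷_)) + Σᵛ m (g ∘ (false ∷_))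
Σᵛ-suc m g = begin
  sum (map g (map (true ∷_) vs List.++ map (false ∷_) vs))
    ≡⟨ cong sum (map-++ g (map (true ∷_) vs) (map (false ∷_) vs)) ⟩
  sum (map g (map (true ∷_) vs) List.++ map g (map (false ∷_) vs))
    ≡⟨ sum-++ (map g (map (true ∷_) vs)) (map g (map (false ∷_) vs)) ⟩
  sum (map g (map (true ∷_) vs)) + sum (map g (map (false ∷_) vs))
    ≡⟨ cong₂ (λ xs ys → sum xs + sum ys) (map-∘ {g = g} {f = true ∷_} vs) (map-∘ {g = g} {f = false ∷_} vs) ⟨
  sum (map (g ∘ (true ∷_)) vs) + sum (map (g ∘ (false ∷_)) vs) ∎
  where
  open ≡-Reasoning
  vs = allVecs m

Σᵛ-cong : ∀ m {g h} → (∀ v → g v ≡ h v) → Σᵛ m g ≡ Σᵛ m h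
Σᵛ-cong m eq = sum-map-cong (allVecs m) λ {v} _ → eq v

Σᵛ-mono : ∀ m {g h} → (∀ v → g v ≤ h v) → Σᵛ m g ≤ Σᵛ m h
Σᵛ-mono m le = sum-map-mono (allVecs m) λ {v} _ → le v

Σᵛ-+ : ∀ m g h → Σᵛ m (λ v → g v + h v) ≡ Σᵛ m g + Σᵛ m h
Σᵛ-+ m g h = go (allVecs m)
  where
  go : ∀ vs → sum (map (λ v → g v + h v) vs) ≡ sum (map g vs) + sum (map h vs)
  go [] = refl
  go (v ∷ vs) = trans (cong (g v + h v +_) (go vs))
    (solve 4 (λ a b c d → (a :+ b) :+ (c :+ d) := (a :+ c) :+ (b :+ d)) refl (g v) (h v) _ _)

Σᵛ-* : ∀ m k g → Σᵛ m (λ v → k * g v) ≡ k * Σᵛ m g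
Σᵛ-* m k g = go (allVecs m)
  where
  go : ∀ vs → sum (map (λ v → k * g v) vs) ≡ k * sum (map g vs)
  go [] = sym (ℕ.*-zeroʳ k)
  go (v ∷ vs) = trans (cong (k * g v +_) (go vs)) (sym (ℕ.*-distribˡ-+ k (g v) _))

Σᵛ-const : ∀ m k → Σᵛ m (λ _ → k) ≡ 2 ^ m * k
Σᵛ-const zero k = refl
Σᵛ-const (suc m) k = trans (Σᵛ-suc m (λ _ → k)) (trans (cong₂ _+_ (Σᵛ-const m k) (Σᵛ-const m k))
  (solve 2 (λ p k → p :* k :+ p :* k := (con 2 :* p) :* k) refl (2 ^ m) k))

Σᵛ-split : ∀ m n (g : Vec Bool m → Vec Bool n → ℕ) →
  Σᵛ (m + n) (λ v → g (take m v) (drop m v)) ≡ Σᵛ m (λ u → Σᵛ n (g u))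
Σᵛ-split zero n g = sym (ℕ.+-identityʳ _)
Σᵛ-split (suc m) n g = trans (Σᵛ-suc (m + n) (λ v → g (take (suc m) v) (drop (suc m) v)))
  (trans (cong₂ _+_ (Σᵛ-split m n (g ∘ (true ∷_))) (Σᵛ-split m n (g ∘ (false ∷_))))
    (sym (Σᵛ-suc m (λ u → Σᵛ n (g u)))))

Σ² : ∀ n → (Vec Bool n → Vec Bool n → ℕ) → ℕ
Σ² n g = Σᵛ n λ as → Σᵛ n (g as)

Σ²-suc : ∀ n g → Σ² (suc n) g ≡
  (Σ² n (λ as bs → g (true ∷ as) (true ∷ bs)) + Σ² n (λ as bs → g (true ∷ as) (false ∷ bs))) +
  (Σ² n (λ as bs → g (false ∷ as) (true ∷ bs)) + Σ² n (λ as bs → g (false ∷ as) (false ∷ bs)))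
Σ²-suc n g = trans (Σᵛ-suc n (λ as → Σᵛ (suc n) (g as))) (cong₂ _+_ (half true) (half false))
  where
  half : ∀ a → Σᵛ n (λ as → Σᵛ (suc n) (g (a ∷ as))) ≡
    Σ² n (λ as bs → g (a ∷ as) (true ∷ bs)) + Σ² n (λ as bs → g (a ∷ as) (false ∷ bs))
  half a = trans (Σᵛ-cong n λ as → Σᵛ-suc n (g (a ∷ as)))
    (Σᵛ-+ n (λ as → Σᵛ n (λ bs → g (a ∷ as) (true ∷ bs))) (λ as → Σᵛ n (λ bs → g (a ∷ as) (false ∷ bs))))

Σ²-shift : ∀ n k g → Σ² n (λ as bs → k + g as bs) ≡ 2 ^ (n + n) * k + Σ² n g
Σ²-shift n k g = begin
  Σ² n (λ as bs → k + g as bs)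
    ≡⟨ Σᵛ-cong n (λ as → trans (Σᵛ-+ n (λ _ → k) (g as)) (cong (_+ Σᵛ n (g as)) (Σᵛ-const n k))) ⟩
  Σᵛ n (λ as → 2 ^ n * k + Σᵛ n (g as))
    ≡⟨ trans (Σᵛ-+ n (λ _ → 2 ^ n * k) (λ as → Σᵛ n (g as))) (cong (_+ Σ² n g) (Σᵛ-const n (2 ^ n * k))) ⟩
  2 ^ n * (2 ^ n * k) + Σ² n g
    ≡⟨ cong (_+ Σ² n g) (trans (sym (ℕ.*-assoc (2 ^ n) (2 ^ n) k)) (cong (_* k) (sym (ℕ.^-distribˡ-+-* 2 n n)))) ⟩
  2 ^ (n + n) * k + Σ² n g ∎
  where open ≡-Reasoning

Σ²-mono : ∀ n {g h} → (∀ as bs → g as bs ≤ h as bs) → Σ² n g ≤ Σ² n h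
Σ²-mono n le = Σᵛ-mono n λ as → Σᵛ-mono n (le as)

Σ²-* : ∀ n k g → Σ² n (λ as bs → k * g as bs) ≡ k * Σ² n g
Σ²-* n k g = trans (Σᵛ-cong n λ as → Σᵛ-* n k (g as)) (Σᵛ-* n k (λ as → Σᵛ n (g as)))

-- Replaces the maximum in `2 ^ longest` by a sum of powers, whose total over all inputs satisfies a
-- recursion in n and d.
potential : ∀ {n} → Vec Bool n → Vec Bool n → ℕ → ℕ
potential [] [] d = 2 ^ d
potential (a ∷ as) (b ∷ bs) d = 2 ^ d + potential as bs (delay a b d)

2^-⊔ : ∀ m n → 2 ^ (m ⊔ n) ≤ 2 ^ m + 2 ^ n
2^-⊔ m n with ℕ.⊔-sel m n
... | inj₁ eq rewrite eq = ℕ.m≤m+n _ _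
... | inj₂ eq rewrite eq = ℕ.m≤n+m _ _

2^longest≤potential : ∀ {n} (as bs : Vec Bool n) d → 2 ^ longest as bs d ≤ potential as bs d
2^longest≤potential [] [] d = ≤-refl
2^longest≤potential (a ∷ as) (b ∷ bs) d = ≤-trans (2^-⊔ d (longest as bs (delay a b d)))
  (ℕ.+-monoʳ-≤ (2 ^ d) (2^longest≤potential as bs (delay a b d)))

-- With q = 2 ^ d, half of the pairs of leading bits double q and half of them reset it to 1.
Σ²-potential : ∀ n d → Σ² n (λ as bs → potential as bs d) ≤ 2 ^ (n + n) * (suc n * 2 ^ d + n * n)
Σ²-potential zero d = ≤-reflexive (solve 1 (λ q → (q :+ con 0) :+ con 0 := con 1 :* (con 1 :* q :+ con 0)) refl (2 ^ d))
Σ²-potential (suc n) d = begin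
  Σ² (suc n) (λ as bs → potential as bs d)
    ≡⟨ Σ²-suc n (λ as bs → potential as bs d) ⟩
  (part 0 + part (suc d)) + (part (suc d) + part 0)
    ≤⟨ ℕ.+-mono-≤ (ℕ.+-mono-≤ (bound 0) (bound (suc d))) (ℕ.+-mono-≤ (bound (suc d)) (bound 0)) ⟩
  (rhs 0 + rhs (suc d)) + (rhs (suc d) + rhs 0)
    -- Raising n² to (n + 1)² gains 4 P (2 n + 1), while the two reset cases use 2 P (n + 1); the
    -- difference is P (6 n + 2).
    ≤⟨ ℕ.m≤m+n _ (P * (6 * n + 2)) ⟩
  ((rhs 0 + rhs (suc d)) + (rhs (suc d) + rhs 0)) + P * (6 * n + 2)
    ≡⟨ solve 3 (λ p q n →
         let r = λ x → p :* q :+ p :* ((con 1 :+ n) :* x :+ n :* n) in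
         ((r (con 1) :+ r (con 2 :* q)) :+ (r (con 2 :* q) :+ r (con 1))) :+ p :* (con 6 :* n :+ con 2) :=
         (con 2 :* (con 2 :* p)) :* ((con 2 :+ n) :* q :+ (con 1 :+ n) :* (con 1 :+ n))) refl P (2 ^ d) n ⟩
  2 * (2 * P) * (suc (suc n) * 2 ^ d + suc n * suc n)
    ≡⟨ cong (λ k → 2 ^ k * (suc (suc n) * 2 ^ d + suc n * suc n)) (sym (ℕ.+-suc (suc n) n)) ⟩
  2 ^ (suc n + suc n) * (suc (suc n) * 2 ^ d + suc n * suc n) ∎
  where
  open ℕ.≤-Reasoning
  P = 2 ^ (n + n)
  part rhs : ℕ → ℕ
  part e = Σ² n (λ as bs → 2 ^ d + potential as bs e)
  rhs e = P * 2 ^ d + P * (suc n * 2 ^ e + n * n)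
  bound : ∀ e → part e ≤ rhs e
  bound e = ≤-trans (≤-reflexive (Σ²-shift n (2 ^ d) (λ as bs → potential as bs e)))
    (ℕ.+-monoʳ-≤ (P * 2 ^ d) (Σ²-potential n e))

n≤2^n : ∀ n → n ≤ 2 ^ n
n≤2^n zero = z≤n
n≤2^n (suc n) = ≤-trans (ℕ.+-mono-≤ (ℕ.m^n>0 2 n) (n≤2^n n)) (ℕ.+-monoʳ-≤ (2 ^ n) (ℕ.m≤m+n _ 0))

-- k ≤ L + 2 ^ (k - L), multiplied through by 2 ^ L.
truncation : ∀ L k → 2 ^ L * k ≤ 2 ^ L * L + 2 ^ k
truncation L k with ℕ.≤-total k L
... | inj₁ k≤L = ≤-trans (ℕ.*-monoʳ-≤ (2 ^ L) k≤L) (ℕ.m≤m+n _ _)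
... | inj₂ L≤k with j , refl ← ℕ.m≤n⇒∃[o]m+o≡n L≤k = begin
  2 ^ L * (L + j)           ≡⟨ ℕ.*-distribˡ-+ (2 ^ L) L j ⟩
  2 ^ L * L + 2 ^ L * j     ≤⟨ ℕ.+-monoʳ-≤ (2 ^ L * L) (ℕ.*-monoʳ-≤ (2 ^ L) (n≤2^n j)) ⟩
  2 ^ L * L + 2 ^ L * 2 ^ j ≡⟨ cong (2 ^ L * L +_) (sym (ℕ.^-distribˡ-+-* 2 L j)) ⟩
  2 ^ L * L + 2 ^ (L + j)   ∎
  where open ℕ.≤-Reasoning

n≤2^[1+log₂n] : ∀ n → n ≤ 2 ^ (⌊log₂ n ⌋ + 1)
n≤2^[1+log₂n] n with ℕ.≤-total n (2 ^ (⌊log₂ n ⌋ + 1))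
... | inj₁ le = le
... | inj₂ ge = contradiction (≤-trans (≤-reflexive (sym (⌊log₂[2^n]⌋≡n (⌊log₂ n ⌋ + 1)))) (⌊log₂⌋-mono-≤ ge))
  (ℕ.<⇒≱ (ℕ.m<m+n ⌊log₂ n ⌋ (s≤s z≤n)))

-- With L = 2 ℓ one has n² ≤ 2 ^ L, so averaging `truncation` bounds the mean by L + (n² + n + 1) /
-- 2 ^ L, at most L + 3. The factor `2 ^ L` is carried along and cancelled to avoid the division.
Σ²-longest : ∀ n → 1 ≤ n → let ℓ = ⌊log₂ n ⌋ + 1 in
  Σ² n (λ as bs → longest as bs 0) ≤ 2 ^ (n + n) * (ℓ + ℓ + 3)
Σ²-longest n 1≤n = ℕ.*-cancelˡ-≤ (2 ^ L) {{ℕ.m^n≢0 2 L}} (begin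
  2 ^ L * Σ² n (λ as bs → longest as bs 0)
    ≡⟨ Σ²-* n (2 ^ L) (λ as bs → longest as bs 0) ⟨
  Σ² n (λ as bs → 2 ^ L * longest as bs 0)
    ≤⟨ Σ²-mono n (λ as bs → ≤-trans (truncation L (longest as bs 0))
         (ℕ.+-monoʳ-≤ (2 ^ L * L) (2^longest≤potential as bs 0))) ⟩
  Σ² n (λ as bs → 2 ^ L * L + potential as bs 0)
    ≡⟨ Σ²-shift n (2 ^ L * L) (λ as bs → potential as bs 0) ⟩
  P * (2 ^ L * L) + Σ² n (λ as bs → potential as bs 0)
    ≤⟨ ℕ.+-monoʳ-≤ (P * (2 ^ L * L)) (≤-trans (Σ²-potential n 0) (ℕ.*-monoʳ-≤ P quadratic)) ⟩
  P * (2 ^ L * L) + P * (3 * 2 ^ L)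
    ≡⟨ solve 3 (λ p q l → p :* (q :* l) :+ p :* (con 3 :* q) := q :* (p :* (l :+ con 3))) refl P (2 ^ L) L ⟩
  2 ^ L * (P * (L + 3)) ∎)
  where
  open ℕ.≤-Reasoning
  ℓ = ⌊log₂ n ⌋ + 1
  L = ℓ + ℓ
  P = 2 ^ (n + n)
  square : n * n ≤ 2 ^ L
  square = ≤-trans (ℕ.*-mono-≤ (n≤2^[1+log₂n] n) (n≤2^[1+log₂n] n)) (≤-reflexive (sym (ℕ.^-distribˡ-+-* 2 ℓ ℓ)))
  n≤n*n : n ≤ n * n
  n≤n*n = ≤-trans (≤-reflexive (sym (ℕ.*-identityʳ n))) (ℕ.*-monoʳ-≤ n 1≤n)
  quadratic : suc n * 2 ^ 0 + n * n ≤ 3 * 2 ^ L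
  quadratic = begin
    suc n * 1 + n * n           ≡⟨ solve 1 (λ n → (con 1 :+ n) :* con 1 :+ n :* n := con 1 :+ (n :+ n :* n)) refl n ⟩
    1 + (n + n * n)             ≤⟨ ℕ.+-mono-≤ (ℕ.m^n>0 2 L) (ℕ.+-mono-≤ (≤-trans n≤n*n square) square) ⟩
    2 ^ L + (2 ^ L + 2 ^ L)     ≡⟨ solve 1 (λ q → q :+ (q :+ q) := con 3 :* q) refl (2 ^ L) ⟩
    3 * 2 ^ L                   ∎

longest≤ : ∀ {n} (as bs : Vec Bool n) d → longest as bs d ≤ d + n
longest≤ [] [] d = ℕ.m≤m+n d 0
longest≤ {suc n} (a ∷ as) (b ∷ bs) d = ℕ.⊔-lub (ℕ.m≤m+n d (suc n)) (≤-trans (longest≤ as bs (delay a b d)) delayed)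
  where
  delayed : delay a b d + n ≤ d + suc n
  delayed with a xor b
  ... | true = ≤-reflexive (sym (ℕ.+-suc d n))
  ... | false = ≤-trans (ℕ.n≤1+n n) (ℕ.m≤n+m (suc n) d)

theorem3 : Σ ℕ λ K → (n : ℕ) → 1 ≤ n →
    Σ (TAC (n + n) (suc n)) λ M → IsAdder n M ×
    Σ (Vec Bool (n + n) → ℕ) λ rt →
    (∀ b → RunTime (tiles M) (τ M) (inputAsm M b) (rt b)) ×
    (∀ b → rt b ≤ K * n) ×
    sum (map rt (allVecs (n + n))) ≤ K * (⌊log₂ n ⌋ + 1) * 2 ^ (n + n)
-- The mean is at most 9 + 3 (2 ℓ + 3), which equals 24 at ℓ = 1 and stays below 24 ℓ afterwards;
-- the worst case gives 9 + 3 n, at most 12 n.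
theorem3 = 24 , λ n 1≤n → adder n
    , ((λ b → total (take n b) (drop n b) false) , computes n , λ b → total-val (take n b) (drop n b) false)
    , (λ b → proj₁ (runs n b)) , (λ b → proj₁ (proj₂ (runs n b))) , worst n 1≤n , average n 1≤n
  where
  computes : ∀ n → Computes (adder n) (λ b → total (take n b) (drop n b) false)
  computes n b = Result.F as bs
    , subst (λ v → UniquelyAssembles tileSet 2 (inputAsm (adder n) v) (Result.F as bs)) (take++drop≡id n b) (Result.assembles as bs)
    , Result.represents as bs
    where
    as = take n b
    bs = drop n b
  runs : ∀ n b → ∃[ k ] RunTime tileSet 2 (inputAsm (adder n) b) k × k ≤ 9 + longest (take n b) (drop n b) 0 * 3
  runs n b = subst (λ v → ∃[ k ] RunTime tileSet 2 (inputAsm (adder n) v) k × k ≤ 9 + longest (take n b) (drop n b) 0 * 3)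
    (take++drop≡id n b) (Result.runTime (take n b) (drop n b))
  open ℕ.≤-Reasoning
  worst : ∀ n → 1 ≤ n → ∀ b → proj₁ (runs n b) ≤ 24 * n
  worst n 1≤n b = begin
    proj₁ (runs n b)                         ≤⟨ proj₂ (proj₂ (runs n b)) ⟩
    9 + longest (take n b) (drop n b) 0 * 3  ≤⟨ ℕ.+-mono-≤ (ℕ.*-monoʳ-≤ 9 1≤n) (ℕ.*-monoˡ-≤ 3 (longest≤ (take n b) (drop n b) 0)) ⟩
    9 * n + n * 3                            ≡⟨ solve 1 (λ n → con 9 :* n :+ n :* con 3 := con 12 :* n) refl n ⟩
    12 * n                                   ≤⟨ ℕ.*-monoˡ-≤ n (ℕ.m≤m+n 12 12) ⟩
    24 * n                                   ∎
  average : ∀ n → 1 ≤ n → Σᵛ (n + n) (λ b → proj₁ (runs n b)) ≤ 24 * (⌊log₂ n ⌋ + 1) * 2 ^ (n + n)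
  average n 1≤n = begin
    Σᵛ (n + n) (λ b → proj₁ (runs n b))
      ≤⟨ Σᵛ-mono (n + n) (λ b → proj₂ (proj₂ (runs n b))) ⟩
    Σᵛ (n + n) (λ b → 9 + longest (take n b) (drop n b) 0 * 3)
      ≡⟨ Σᵛ-split n n (λ as bs → 9 + longest as bs 0 * 3) ⟩
    Σ² n (λ as bs → 9 + longest as bs 0 * 3)
      ≤⟨ Σ²-mono n (λ as bs → ≤-reflexive (cong (9 +_) (ℕ.*-comm (longest as bs 0) 3))) ⟩
    Σ² n (λ as bs → 9 + 3 * longest as bs 0)
      ≡⟨ trans (Σ²-shift n 9 (λ as bs → 3 * longest as bs 0)) (cong (P * 9 +_) (Σ²-* n 3 (λ as bs → longest as bs 0))) ⟩
    P * 9 + 3 * Σ² n (λ as bs → longest as bs 0)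
      ≤⟨ ℕ.+-monoʳ-≤ (P * 9) (ℕ.*-monoʳ-≤ 3 (Σ²-longest n 1≤n)) ⟩
    P * 9 + 3 * (P * (ℓ + ℓ + 3))
      -- Per input the bound is 24 + 6 ⌊log₂ n⌋, which is 18 ⌊log₂ n⌋ short of 24 ℓ.
      ≤⟨ ℕ.m≤m+n _ (18 * ⌊log₂ n ⌋ * P) ⟩
    P * 9 + 3 * (P * (ℓ + ℓ + 3)) + 18 * ⌊log₂ n ⌋ * P
      ≡⟨ solve 2 (λ p l → p :* con 9 :+ con 3 :* (p :* ((l :+ con 1) :+ (l :+ con 1) :+ con 3)) :+ con 18 :* l :* p
                          := con 24 :* (l :+ con 1) :* p) refl P ⌊log₂ n ⌋ ⟩
    24 * ℓ * P ∎
    where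
    P = 2 ^ (n + n)
    ℓ = ⌊log₂ n ⌋ + 1
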